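{- Let $(\alpha_n)_{n\ge0}$ be complex numbers with $|\alpha_n|<1$ and let $\mu_{n,r,s}$ be as in the context. For all nonnegative integers $n,r,s$, \[ \mu_{n,r,s}=\sum_{p\in\mathrm{gMot}((-r,r)\to(2n-s,s))}\mathrm{wt}_M(p). \]
   Context: For a polynomial $f(z)=\sum_{k=0}^n a_kz^k$ of degree $n$, write $\overline{f}(z)=\sum_k\overline{a_k}z^k$ and $f^*(z)=z^n\overline{f}(1/z)$. Define monic $\Phi_n$ by $\Phi_0=1$, $\Phi_{n+1}(z)=z\Phi_n(z)-\overline{\alpha_n}\Phi_n^*(z)$. Let $\mathcal{L}$ be the unique linear functional on Laurent polynomials with $\mathcal{L}(1)=1$ and $\mathcal{L}(\Phi_m(z)\overline{\Phi_n}(1/z))=0$ for $m\neq n$; set $\langle f,g\rangle=\mathcal{L}(f(z)\overline{g}(1/z))$ and $\mu_{n,r,s}=\langle\Phi_s(z),z^n\Phi_r(z)\rangle/\langle\Phi_s,\Phi_s\rangle$. Set $\alpha_{ -1}=-1$. A gentle Motzkin path is a lattice path in $\mathbb{Z}\times\mathbb{Z}_{\ge0}$ with steps $(1,1)$, $(1,0)$, $(1,-1)$ such that an up-step $(a,b)\to(a+1,b+1)$ occurs only when $a+b$ is even and a down-step $(a,b)\to(a+1,b-1)$ occurs only when $a+b$ is odd. $\mathrm{gMot}((a,b)\to(c,d))$ denotes the set of gentle Motzkin paths from $(a,b)$ to $(c,d)$. The weight $\mathrm{wt}_M(p)$ is the product of step weights: up-step weight $1$; down-step $(a,b)\to(a+1,b-1)$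 weight $1-|\alpha_{b-1}|^2$; horizontal step $(a,b)\to(a+1,b)$ weight $\alpha_b$ if $a+b$ is even and $-\overline{\alpha_{b-1}}$ if $a+b$ is odd. -}

module Defs where

open import Algebra.Bundles.Raw using (RawRing)
open import Algebra.Module.Bundles.Raw using (RawLeftModule)
open import Algebra.Module.Construct.TensorUnit using (rawLeftModule)
open import Algebra.Module.Morphism.Structures using (module LeftModuleMorphisms)
open import Axiom.UniquenessOfIdentityProofs using (module Decidable⇒UIP)
open import Data.Empty using (⊥-elim)
open import Data.Integer.Base as ℤ using (ℤ; +_; -[1+_])
import Data.Integer.Properties as ℤ
open import Data.Integer.Solver using () renaming (module +-*-Solver to ℤSolver)
open import Data.List.Base using (List; []; _∷_; [_]; _++_; map; filter; foldr; cartesianProductWith)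
open import Data.List.Membership.Propositional using (_∈_)
open import Data.List.Membership.Propositional.Properties using (∈-++⁺ˡ; ∈-++⁺ʳ; ∈-++⁻; ∈-map⁺; ∈-map⁻)
open import Data.List.Relation.Unary.All using ([])
open import Data.List.Relation.Unary.AllPairs using ([]; _∷_)
open import Data.List.Relation.Unary.Any using (here)
open import Data.List.Relation.Unary.Unique.Propositional using (Unique)
import Data.List.Relation.Unary.Unique.Propositional.Properties as Unique
open import Data.Nat.Base as ℕ using (ℕ; zero; suc; parity)
import Data.Nat.Properties as ℕ
open import Data.Parity.Base using (Parity; 0ℙ; 1ℙ)
open import Data.Parity.Properties using () renaming (_≟_ to _≟ℙ_)
open import Data.Product.Base using (∃; _×_; _,_; proj₁; proj₂)
open import Data.Product.Properties using (≡-dec)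
open import Data.Rational.Base as ℚ using (ℚ; 0ℚ; 1ℚ; ½; _<_; _≤_; ∣_∣)
import Data.Rational.Properties as ℚ
open import Data.Rational.Solver using (module +-*-Solver)
open import Data.Sum.Base using (inj₁; inj₂)
open import Level using (0ℓ)
open import Relation.Binary.Construct.Closure.ReflexiveTransitive using (Star; ε; _◅_; fold)
open import Relation.Binary.Definitions using (DecidableEquality)
open import Relation.Binary.PropositionalEquality hiding ([_])
open import Relation.Nullary using (¬_; yes; no)

------------------------------------------------------------------------
-- Real numbers: Cauchy sequences of rationals.  Two reals are
-- identified by _≈ℝ_ when the difference of the sequences tends to 0.

IsCauchy : (ℕ → ℚ) → Set
IsCauchy x = ∀ δ → 0ℚ < δ → ∃ λ N → ∀ m n → N ℕ.≤ m → N ℕ.≤ n → ∣ x m ℚ.- x n ∣ < δ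

record ℝ : Set where
  constructor mkℝ
  field
    seq    : ℕ → ℚ
    cauchy : IsCauchy seq

open ℝ public

infix 4 _≈ℝ_ _<ℝ_

record _≈ℝ_ (x y : ℝ) : Set where
  constructor mk≈ℝ
  field
    close : ∀ δ → 0ℚ < δ → ∃ λ N → ∀ n → N ℕ.≤ n → ∣ seq x n ℚ.- seq y n ∣ < δ

_<ℝ_ : ℝ → ℝ → Set
x <ℝ y = ∃ λ δ → 0ℚ < δ × ∃ λ N → ∀ n → N ℕ.≤ n → seq x n ℚ.+ δ < seq y n

private
  module R = ℚ.≤-Reasoning

  _⊔_ = ℕ._⊔_

⊔-≤ˡ : ∀ {m n o} → m ⊔ n ℕ.≤ o → m ℕ.≤ o
⊔-≤ˡ {m} {n} = ℕ.≤-trans (ℕ.m≤m⊔n m n)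

⊔-≤ʳ : ∀ {m n o} → m ⊔ n ℕ.≤ o → n ℕ.≤ o
⊔-≤ʳ {m} {n} = ℕ.≤-trans (ℕ.m≤n⊔m m n)

*-pos : ∀ {p q} → 0ℚ < p → 0ℚ < q → 0ℚ < p ℚ.* q
*-pos {p} {q} 0<p 0<q = ℚ.positive⁻¹ _ {{ℚ.pos*pos⇒pos p {{ℚ.positive 0<p}} q {{ℚ.positive 0<q}}}}

0<½ : 0ℚ < ½
0<½ = ℚ.positive⁻¹ ½

half : ∀ p → ½ ℚ.* p ℚ.+ ½ ℚ.* p ≡ p
half p = trans (sym (ℚ.*-distribʳ-+ p ½ ½)) (ℚ.*-identityˡ p)

∣∣-bound : ∀ p q {B C} → ∣ p ∣ < B → ∣ q ∣ < C → ∣ p ℚ.* q ∣ < B ℚ.* C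
∣∣-bound p q {B} {C} p<B q<C = R.begin-strict
  ∣ p ℚ.* q ∣      R.≡⟨ ℚ.∣p*q∣≡∣p∣*∣q∣ p q ⟩
  ∣ p ∣ ℚ.* ∣ q ∣  R.≤⟨ ℚ.*-monoʳ-≤-nonNeg ∣ q ∣ {{ℚ.∣-∣-nonNeg q}} (ℚ.<⇒≤ p<B) ⟩
  B ℚ.* ∣ q ∣      R.<⟨ ℚ.*-monoʳ-<-pos B {{ℚ.positive (ℚ.≤-<-trans (ℚ.0≤∣p∣ p) p<B)}} q<C ⟩
  B ℚ.* C          R.∎

∣+∣-bound : ∀ p q {B C} → ∣ p ∣ < B → ∣ q ∣ < C → ∣ p ℚ.+ q ∣ < B ℚ.+ C
∣+∣-bound p q p<B q<C = ℚ.≤-<-trans (ℚ.∣p+q∣≤∣p∣+∣q∣ p q) (ℚ.+-mono-< p<B q<C)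

-- The reciprocal on ℚ, made total by sending 0 to 0.

recip : ℚ → ℚ
recip q with q ℚ.≟ 0ℚ
... | yes _  = 0ℚ
... | no q≢0 = (ℚ.1/ q) {{ℚ.≢-nonZero q≢0}}

recip-inverse : ∀ q → q ≢ 0ℚ → q ℚ.* recip q ≡ 1ℚ
recip-inverse q q≢0 with q ℚ.≟ 0ℚ
... | yes q≡0 = ⊥-elim (q≢0 q≡0)
... | no  q≢0′ = ℚ.*-inverseʳ q {{ℚ.≢-nonZero q≢0′}}

recip-pos : ∀ q → 0ℚ < q → 0ℚ < recip q
recip-pos q 0<q with q ℚ.≟ 0ℚ
... | yes q≡0 = ⊥-elim (ℚ.<-irrefl (sym q≡0) 0<q)
... | no  q≢0 = ℚ.positive⁻¹ _ {{ℚ.1/pos⇒pos q {{ℚ.positive 0<q}}}}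

pos⇒≢0 : ∀ {q} → 0ℚ < q → q ≢ 0ℚ
pos⇒≢0 0<q q≡0 = ℚ.<-irrefl (sym q≡0) 0<q

recip-< : ∀ {d q} → 0ℚ < d → d < q → recip q < recip d
recip-< {d} {q} 0<d d<q =
  subst₂ _<_ e₁ e₂ (ℚ.*-monoˡ-<-pos (recip d ℚ.* recip q) {{ℚ.positive (*-pos 0<rd 0<rq)}} d<q)
  where
  0<q  = ℚ.<-trans 0<d d<q
  0<rd = recip-pos d 0<d
  0<rq = recip-pos q 0<q
  open ≡-Reasoning
  e₁ : d ℚ.* (recip d ℚ.* recip q) ≡ recip q
  e₁ = begin
    d ℚ.* (recip d ℚ.* recip q)  ≡⟨ ℚ.*-assoc d (recip d) (recip q) ⟨
    d ℚ.* recip d ℚ.* recip q    ≡⟨ cong (ℚ._* recip q) (recip-inverse d (pos⇒≢0 0<d)) ⟩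
    1ℚ ℚ.* recip q               ≡⟨ ℚ.*-identityˡ _ ⟩
    recip q                      ∎
  e₂ : q ℚ.* (recip d ℚ.* recip q) ≡ recip d
  e₂ = begin
    q ℚ.* (recip d ℚ.* recip q)  ≡⟨ cong (q ℚ.*_) (ℚ.*-comm (recip d) (recip q)) ⟩
    q ℚ.* (recip q ℚ.* recip d)  ≡⟨ ℚ.*-assoc q (recip q) (recip d) ⟨
    q ℚ.* recip q ℚ.* recip d    ≡⟨ cong (ℚ._* recip d) (recip-inverse q (pos⇒≢0 0<q)) ⟩
    1ℚ ℚ.* recip d               ≡⟨ ℚ.*-identityˡ _ ⟩
    recip d                      ∎

recip-diff : ∀ p q → p ≢ 0ℚ → q ≢ 0ℚ →
             recip p ℚ.- recip q ≡ (recip p ℚ.* recip q) ℚ.* (q ℚ.- p)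
recip-diff p q p≢0 q≢0 = begin
  recip p ℚ.- recip q
    ≡⟨ cong₂ ℚ._-_ (ℚ.*-identityʳ (recip p)) (ℚ.*-identityʳ (recip q)) ⟨
  recip p ℚ.* 1ℚ ℚ.- recip q ℚ.* 1ℚ
    ≡⟨ cong₂ (λ u v → recip p ℚ.* u ℚ.- recip q ℚ.* v) (recip-inverse q q≢0) (recip-inverse p p≢0) ⟨
  recip p ℚ.* (q ℚ.* recip q) ℚ.- recip q ℚ.* (p ℚ.* recip p)
    ≡⟨ solve 4 (λ a b c d → a :* (b :* c) :- c :* (d :* a) := (a :* c) :* (b :- d)) refl (recip p) q (recip q) p ⟩
  (recip p ℚ.* recip q) ℚ.* (q ℚ.- p) ∎
  where open ≡-Reasoning
        open +-*-Solver

cancel-bound : ∀ B δ → 0ℚ < B → B ℚ.* (δ ℚ.* recip B) ≡ δ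
cancel-bound B δ 0<B = begin
  B ℚ.* (δ ℚ.* recip B)  ≡⟨ solve 3 (λ a b c → a :* (b :* c) := (a :* c) :* b) refl B δ (recip B) ⟩
  B ℚ.* recip B ℚ.* δ    ≡⟨ cong (ℚ._* δ) (recip-inverse B (pos⇒≢0 0<B)) ⟩
  1ℚ ℚ.* δ               ≡⟨ ℚ.*-identityˡ δ ⟩
  δ                      ∎
  where open ≡-Reasoning
        open +-*-Solver

bounded : ∀ x → ∃ λ B → 0ℚ < B × ∃ λ N → ∀ n → N ℕ.≤ n → ∣ seq x n ∣ < B
bounded (mkℝ x cx) with cx 1ℚ (ℚ.positive⁻¹ 1ℚ)
... | N , h = 1ℚ ℚ.+ ∣ x N ∣ ,
  ℚ.<-≤-trans (ℚ.positive⁻¹ 1ℚ) (subst (_≤ 1ℚ ℚ.+ ∣ x N ∣) (ℚ.+-identityʳ 1ℚ) (ℚ.+-monoʳ-≤ 1ℚ (ℚ.0≤∣p∣ (x N)))) ,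
  N , λ n N≤n → R.begin-strict
    ∣ x n ∣                          R.≡⟨ cong ∣_∣ (solve 2 (λ a b → a := a :- b :+ b) refl (x n) (x N)) ⟩
    ∣ x n ℚ.- x N ℚ.+ x N ∣          R.≤⟨ ℚ.∣p+q∣≤∣p∣+∣q∣ (x n ℚ.- x N) (x N) ⟩
    ∣ x n ℚ.- x N ∣ ℚ.+ ∣ x N ∣      R.<⟨ ℚ.+-monoˡ-< ∣ x N ∣ (h n N N≤n ℕ.≤-refl) ⟩
    1ℚ ℚ.+ ∣ x N ∣                   R.∎
  where open +-*-Solver

-- Opaque, so that real numbers do not unfold into these proofs.

abstract

  const-cauchy : ∀ q → IsCauchy (λ _ → q)
  const-cauchy q δ 0<δ = 0 , λ _ _ _ _ → subst (_< δ) (sym (cong ∣_∣ (ℚ.+-inverseʳ q))) 0<δ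

  +-cauchy : ∀ x y → IsCauchy (λ n → seq x n ℚ.+ seq y n)
  +-cauchy (mkℝ x cx) (mkℝ y cy) δ 0<δ =
    let M , hx = cx (½ ℚ.* δ) (*-pos 0<½ 0<δ)
        N , hy = cy (½ ℚ.* δ) (*-pos 0<½ 0<δ)
    in M ⊔ N , λ m n ≤m ≤n → subst₂ _<_
      (cong ∣_∣ (solve 4 (λ a b c d → a :- b :+ (c :- d) := a :+ c :- (b :+ d)) refl (x m) (x n) (y m) (y n)))
      (half δ)
      (∣+∣-bound (x m ℚ.- x n) (y m ℚ.- y n)
        (hx m n (⊔-≤ˡ ≤m) (⊔-≤ˡ ≤n)) (hy m n (⊔-≤ʳ {M} ≤m) (⊔-≤ʳ {M} ≤n)))
    where open +-*-Solver

  neg-cauchy : ∀ x → IsCauchy (λ n → ℚ.- seq x n)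
  neg-cauchy (mkℝ x cx) δ 0<δ =
    let N , h = cx δ 0<δ
    in N , λ m n ≤m ≤n → subst (_< δ)
      (trans (sym (ℚ.∣-p∣≡∣p∣ (x m ℚ.- x n)))
             (cong ∣_∣ (solve 2 (λ a b → :- (a :- b) := :- a :- :- b) refl (x m) (x n))))
      (h m n ≤m ≤n)
    where open +-*-Solver

  *-cauchy : ∀ x y → IsCauchy (λ n → seq x n ℚ.* seq y n)
  *-cauchy (mkℝ x cx) (mkℝ y cy) δ 0<δ =
    let B , 0<B , K , bx = bounded (mkℝ x cx)
        C , 0<C , L , by = bounded (mkℝ y cy)
        M , hx = cx (½ ℚ.* δ ℚ.* recip C) (*-pos (*-pos 0<½ 0<δ) (recip-pos C 0<C))
        N , hy = cy (½ ℚ.* δ ℚ.* recip B) (*-pos (*-pos 0<½ 0<δ) (recip-pos B 0<B))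
    in (K ⊔ L) ⊔ (M ⊔ N) , λ m n ≤m ≤n → subst₂ _<_
      (cong ∣_∣ (solve 4 (λ a b c d → a :* (c :- d) :+ d :* (a :- b) := a :* c :- b :* d) refl (x m) (x n) (y m) (y n)))
      (trans (cong₂ ℚ._+_ (cancel-bound B (½ ℚ.* δ) 0<B) (cancel-bound C (½ ℚ.* δ) 0<C)) (half δ))
      (∣+∣-bound (x m ℚ.* (y m ℚ.- y n)) (y n ℚ.* (x m ℚ.- x n))
        (∣∣-bound (x m) (y m ℚ.- y n) (bx m (⊔-≤ˡ (⊔-≤ˡ ≤m)))
          (hy m n (⊔-≤ʳ {M} (⊔-≤ʳ {K ⊔ L} ≤m)) (⊔-≤ʳ {M} (⊔-≤ʳ {K ⊔ L} ≤n))))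
        (∣∣-bound (y n) (x m ℚ.- x n) (by n (⊔-≤ʳ {K} (⊔-≤ˡ ≤n)))
          (hx m n (⊔-≤ˡ (⊔-≤ʳ {K ⊔ L} ≤m)) (⊔-≤ˡ (⊔-≤ʳ {K ⊔ L} ≤n)))))
    where open +-*-Solver

  recip-cauchy : ∀ x {d} → 0ℚ < d → ∀ {K} → (∀ n → K ℕ.≤ n → d < seq x n) →
                 IsCauchy (λ n → recip (seq x n))
  recip-cauchy (mkℝ x cx) {d} 0<d {K} d<x δ 0<δ =
    let B = recip d ℚ.* recip d
        0<B = *-pos (recip-pos d 0<d) (recip-pos d 0<d)
        N , h = cx (δ ℚ.* recip B) (*-pos 0<δ (recip-pos B 0<B))
    in K ⊔ N , λ m n ≤m ≤n → subst₂ _<_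
      (cong ∣_∣ (sym (recip-diff (x m) (x n) (pos⇒≢0 (0<x m (⊔-≤ˡ ≤m))) (pos⇒≢0 (0<x n (⊔-≤ˡ ≤n))))))
      (cancel-bound B δ 0<B)
      (∣∣-bound (recip (x m) ℚ.* recip (x n)) (x n ℚ.- x m)
        (∣∣-bound (recip (x m)) (recip (x n)) (bound m (⊔-≤ˡ ≤m)) (bound n (⊔-≤ˡ ≤n)))
        (h n m (⊔-≤ʳ {K} ≤n) (⊔-≤ʳ {K} ≤m)))
    where
    0<x : ∀ n → K ℕ.≤ n → 0ℚ < x n
    0<x n K≤n = ℚ.<-trans 0<d (d<x n K≤n)
    bound : ∀ n → K ℕ.≤ n → ∣ recip (x n) ∣ < recip d
    bound n K≤n = subst (_< recip d) (sym (ℚ.0≤p⇒∣p∣≡p (ℚ.<⇒≤ (recip-pos (x n) (0<x n K≤n)))))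
                        (recip-< 0<d (d<x n K≤n))

fromℚ : ℚ → ℝ
fromℚ q = mkℝ (λ _ → q) (const-cauchy q)

0ℝ 1ℝ : ℝ
0ℝ = fromℚ 0ℚ
1ℝ = fromℚ 1ℚ

infix  8 -ℝ_
infixl 7 _*ℝ_
infixl 6 _+ℝ_ _-ℝ_

_+ℝ_ _*ℝ_ : ℝ → ℝ → ℝ
x +ℝ y = mkℝ (λ n → seq x n ℚ.+ seq y n) (+-cauchy x y)
x *ℝ y = mkℝ (λ n → seq x n ℚ.* seq y n) (*-cauchy x y)

-ℝ_ : ℝ → ℝ
-ℝ x = mkℝ (λ n → ℚ.- seq x n) (neg-cauchy x)

_-ℝ_ : ℝ → ℝ → ℝ
x -ℝ y = x +ℝ (-ℝ y)

inverseℝ : (x : ℝ) → 0ℝ <ℝ x → ℝ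
inverseℝ x (d , 0<d , K , 0+d<x) =
  mkℝ (λ n → recip (seq x n))
      (recip-cauchy x 0<d λ n K≤n → subst (_< seq x n) (ℚ.+-identityˡ d) (0+d<x n K≤n))

------------------------------------------------------------------------
-- Complex numbers

infix 5 _+i_

record ℂ : Set where
  constructor _+i_
  field
    re im : ℝ

open ℂ public

infix  4 _≈ℂ_ _#0
infix  8 -ℂ_
infixl 7 _*ℂ_
infixl 6 _+ℂ_ _-ℂ_

record _≈ℂ_ (z w : ℂ) : Set where
  constructor mk≈ℂ
  field
    re-≈ : re z ≈ℝ re w
    im-≈ : im z ≈ℝ im w

ofℝ : ℝ → ℂ
ofℝ x = x +i 0ℝ

0ℂ 1ℂ : ℂ
0ℂ = ofℝ 0ℝ
1ℂ = ofℝ 1ℝ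

_+ℂ_ _-ℂ_ _*ℂ_ : ℂ → ℂ → ℂ
z +ℂ w = (re z +ℝ re w) +i (im z +ℝ im w)
z -ℂ w = (re z -ℝ re w) +i (im z -ℝ im w)
z *ℂ w = (re z *ℝ re w -ℝ im z *ℝ im w) +i (re z *ℝ im w +ℝ im z *ℝ re w)

-ℂ_ : ℂ → ℂ
-ℂ z = (-ℝ re z) +i (-ℝ im z)

conj : ℂ → ℂ
conj z = re z +i (-ℝ im z)

∣_∣² : ℂ → ℝ
∣ z ∣² = re z *ℝ re z +ℝ im z *ℝ im z

-- |z| < 1, expressed as |z|² < 1 to avoid a square root.

∣_∣<1 : ℂ → Set
∣ z ∣<1 = ∣ z ∣² <ℝ 1ℝ

-- Being distinct from 0 in the positive sense that allows division.

_#0 : ℂ → Set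
z #0 = 0ℝ <ℝ ∣ z ∣²

divide : (w z : ℂ) → z #0 → ℂ
divide w z z#0 = w *ℂ conj z *ℂ ofℝ (inverseℝ ∣ z ∣² z#0)

∑ : List ℂ → ℂ
∑ = foldr _+ℂ_ 0ℂ

ℂ-rawRing : RawRing 0ℓ 0ℓ
ℂ-rawRing = record
  { Carrier = ℂ
  ; _≈_     = _≈ℂ_
  ; _+_     = _+ℂ_
  ; _*_     = _*ℂ_
  ; -_      = -ℂ_
  ; 0#      = 0ℂ
  ; 1#      = 1ℂ
  }

------------------------------------------------------------------------
-- Laurent polynomials: finite formal sums of terms (k , c), standing
-- for c zᵏ.  Exponents may be repeated; two formal sums are identified
-- when all their coefficients agree.

Laurent : Set
Laurent = List (ℤ × ℂ)

coeff : ℤ → Laurent → ℂ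
coeff k f = ∑ (map proj₂ (filter (λ t → proj₁ t ℤ.≟ k) f))

infix  4 _≈ᴸ_
infixl 6 _-ᴸ_
infixr 7 _·_ _*ᴸ_

_≈ᴸ_ : Laurent → Laurent → Set
f ≈ᴸ g = ∀ k → coeff k f ≈ℂ coeff k g

_·_ : ℂ → Laurent → Laurent
c · f = map (λ (k , a) → k , c *ℂ a) f

-ᴸ_ : Laurent → Laurent
-ᴸ f = map (λ (k , a) → k , -ℂ a) f

_-ᴸ_ : Laurent → Laurent → Laurent
f -ᴸ g = f ++ -ᴸ g

_*ᴸ_ : Laurent → Laurent → Laurent
_*ᴸ_ = cartesianProductWith λ (j , a) (k , b) → j ℤ.+ k , a *ℂ b

z^_ : ℤ → Laurent
z^ k = [ k , 1ℂ ]

1ᴸ : Laurent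
1ᴸ = z^ (+ 0)

bar : Laurent → Laurent
bar = map λ (k , a) → k , conj a

-- f(z) ↦ f(1/z)

reflect : Laurent → Laurent
reflect = map λ (k , a) → ℤ.- k , a

Laurent-rawLeftModule : RawLeftModule ℂ 0ℓ 0ℓ
Laurent-rawLeftModule = record
  { Carrierᴹ = Laurent
  ; _≈ᴹ_     = _≈ᴸ_
  ; _+ᴹ_     = _++_
  ; _*ₗ_     = _·_
  ; 0ᴹ       = []
  ; -ᴹ_      = -ᴸ_
  }

IsLinearFunctional : (Laurent → ℂ) → Set
IsLinearFunctional = IsLeftModuleHomomorphism
  where open LeftModuleMorphisms Laurent-rawLeftModule (rawLeftModule {R = ℂ-rawRing})

------------------------------------------------------------------------
-- Orthogonal polynomials on the unit circle

-- f*(z) = zⁿ f̄(1/z), for f of degree n.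

star : ℕ → Laurent → Laurent
star n f = (z^ (+ n)) *ᴸ reflect (bar f)

module _ (α : ℕ → ℂ) where

  Φ : ℕ → Laurent
  Φ zero    = 1ᴸ
  Φ (suc n) = (z^ (+ 1)) *ᴸ Φ n -ᴸ conj (α n) · star n (Φ n)

⟪_,_⟫[_] : Laurent → Laurent → (Laurent → ℂ) → ℂ
⟪ f , g ⟫[ L ] = L (f *ᴸ reflect (bar g))

IsOrthogonal : (α : ℕ → ℂ) (L : Laurent → ℂ) → Set
IsOrthogonal α L = ∀ m n → m ≢ n → ⟪ Φ α m , Φ α n ⟫[ L ] ≈ℂ 0ℂ

μ : (α : ℕ → ℂ) (L : Laurent → ℂ) (n r s : ℕ) → ⟪ Φ α s , Φ α s ⟫[ L ] #0 → ℂ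
μ α L n r s = divide ⟪ Φ α s , (z^ (+ n)) *ᴸ Φ α r ⟫[ L ] ⟪ Φ α s , Φ α s ⟫[ L ]

------------------------------------------------------------------------
-- Gentle Motzkin paths

Point : Set
Point = ℤ × ℕ

parityAt : ℤ → ℕ → Parity
parityAt a b = parity ℤ.∣ a ℤ.+ + b ∣

data Step : Point → Point → Set where
  up    : ∀ a b → parityAt a b ≡ 0ℙ       → Step (a , b)     (ℤ.suc a , suc b)
  level : ∀ a b                           → Step (a , b)     (ℤ.suc a , b)
  down  : ∀ a b → parityAt a (suc b) ≡ 1ℙ → Step (a , suc b) (ℤ.suc a , b)

Path : Point → Point → Set
Path = Star Step

infix 4 _≟ᴾ_

_≟ᴾ_ : DecidableEquality Point
_≟ᴾ_ = ≡-dec ℤ._≟_ ℕ._≟_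

mutual

  pathsOfLength : ℕ → ∀ P Q → List (Path P Q)
  pathsOfLength zero    P Q with P ≟ᴾ Q
  ... | yes refl = [ ε ]
  ... | no  _    = []
  pathsOfLength (suc k) P Q = upFirst k P Q ++ levelFirst k P Q ++ downFirst k P Q

  upFirst levelFirst downFirst : ℕ → ∀ P Q → List (Path P Q)
  upFirst k (a , b) Q with parityAt a b ≟ℙ 0ℙ
  ... | yes e = map (up a b e ◅_) (pathsOfLength k _ Q)
  ... | no  _ = []
  levelFirst k (a , b) Q = map (level a b ◅_) (pathsOfLength k _ Q)
  downFirst k (a , zero)  Q = []
  downFirst k (a , suc b) Q with parityAt a (suc b) ≟ℙ 1ℙ
  ... | yes o = map (down a b o ◅_) (pathsOfLength k _ Q)
  ... | no  _ = []

-- Every step advances the first coordinate by 1, so every path from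
-- (a , b) to (c , d) has length c - a.

gMot : ∀ P Q → List (Path P Q)
gMot P Q with proj₁ Q ℤ.- proj₁ P
... | + k      = pathsOfLength k P Q
... | -[1+ _ ] = []

private

  ◅-injectiveʳ : ∀ {P Q R} {s : Step P Q} {p q : Path Q R} → _≡_ {A = Path P R} (s ◅ p) (s ◅ q) → p ≡ q
  ◅-injectiveʳ refl = refl

  length : ∀ {P Q} → Path P Q → ℕ
  length ε       = zero
  length (_ ◅ p) = suc (length p)

  advance : ∀ {P Q} → Step P Q → proj₁ Q ≡ ℤ.suc (proj₁ P)
  advance (up _ _ _)   = refl
  advance (level _ _)  = refl
  advance (down _ _ _) = refl

  length-correct : ∀ {P Q} (p : Path P Q) → proj₁ Q ℤ.- proj₁ P ≡ + length p
  length-correct {P} ε = ℤ.+-inverseʳ (proj₁ P)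
  length-correct {P} {Q} (_◅_ {j = S} s p) = begin
    proj₁ Q ℤ.- proj₁ P
      ≡⟨ solve 2 (λ c a → c :- a := con (+ 1) :+ (c :- (con (+ 1) :+ a))) refl (proj₁ Q) (proj₁ P) ⟩
    + 1 ℤ.+ (proj₁ Q ℤ.- ℤ.suc (proj₁ P))
      ≡⟨ cong (λ a → + 1 ℤ.+ (proj₁ Q ℤ.- a)) (advance s) ⟨
    + 1 ℤ.+ (proj₁ Q ℤ.- proj₁ S)
      ≡⟨ cong ℤ.suc (length-correct p) ⟩
    + suc (length p) ∎
    where open ≡-Reasoning
          open ℤSolver

  ∈-pathsOfLength : ∀ {P Q} (p : Path P Q) → p ∈ pathsOfLength (length p) P Q
  ∈-pathsOfLength {P} ε with P ≟ᴾ P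
  ... | yes refl = here refl
  ... | no  P≢P  = ⊥-elim (P≢P refl)
  ∈-pathsOfLength {Q = Q} (up a b e ◅ p) = ∈-++⁺ˡ h
    where
    h : (up a b e ◅ p) ∈ upFirst (length p) (a , b) Q
    h with parityAt a b ≟ℙ 0ℙ
    ... | yes e′ rewrite Decidable⇒UIP.≡-irrelevant _≟ℙ_ e e′ = ∈-map⁺ _ (∈-pathsOfLength p)
    ... | no ¬e  = ⊥-elim (¬e e)
  ∈-pathsOfLength {Q = Q} (level a b ◅ p) =
    ∈-++⁺ʳ (upFirst (length p) (a , b) Q) (∈-++⁺ˡ (∈-map⁺ _ (∈-pathsOfLength p)))
  ∈-pathsOfLength {Q = Q} (down a b o ◅ p) =
    ∈-++⁺ʳ (upFirst (length p) (a , suc b) Q) (∈-++⁺ʳ (levelFirst (length p) (a , suc b) Q) h)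
    where
    h : (down a b o ◅ p) ∈ downFirst (length p) (a , suc b) Q
    h with parityAt a (suc b) ≟ℙ 1ℙ
    ... | yes o′ rewrite Decidable⇒UIP.≡-irrelevant _≟ℙ_ o o′ = ∈-map⁺ _ (∈-pathsOfLength p)
    ... | no ¬o  = ⊥-elim (¬o o)

  data Kind : Set where
    empty up level down : Kind

  kind : ∀ {P Q} → Path P Q → Kind
  kind ε                = empty
  kind (up _ _ _ ◅ _)   = up
  kind (level _ _ ◅ _)  = level
  kind (down _ _ _ ◅ _) = down

  kind-up : ∀ k P Q {p} → p ∈ upFirst k P Q → kind p ≡ up
  kind-up k (a , b) Q p∈ with parityAt a b ≟ℙ 0ℙ
  kind-up k (a , b) Q p∈ | yes _ with ∈-map⁻ _ p∈
  ... | _ , _ , refl = refl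
  kind-up k (a , b) Q () | no _

  kind-level : ∀ k P Q {p} → p ∈ levelFirst k P Q → kind p ≡ level
  kind-level k (a , b) Q p∈ with ∈-map⁻ _ p∈
  ... | _ , _ , refl = refl

  kind-down : ∀ k P Q {p} → p ∈ downFirst k P Q → kind p ≡ down
  kind-down k (a , suc b) Q p∈ with parityAt a (suc b) ≟ℙ 1ℙ
  kind-down k (a , suc b) Q p∈ | yes _ with ∈-map⁻ _ p∈
  ... | _ , _ , refl = refl
  kind-down k (a , suc b) Q () | no _

  pathsOfLength-unique : ∀ k P Q → Unique (pathsOfLength k P Q)
  pathsOfLength-unique zero P Q with P ≟ᴾ Q
  ... | yes refl = [] ∷ []
  ... | no  _    = []
  pathsOfLength-unique (suc k) P Q =
    Unique.++⁺ (unique-up P) (Unique.++⁺ (unique-level P) (unique-down P) level-down) up-rest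
    where
    unique-up : ∀ P → Unique (upFirst k P Q)
    unique-up (a , b) with parityAt a b ≟ℙ 0ℙ
    ... | yes _ = Unique.map⁺ ◅-injectiveʳ (pathsOfLength-unique k _ Q)
    ... | no  _ = []
    unique-level : ∀ P → Unique (levelFirst k P Q)
    unique-level (a , b) = Unique.map⁺ ◅-injectiveʳ (pathsOfLength-unique k _ Q)
    unique-down : ∀ P → Unique (downFirst k P Q)
    unique-down (a , zero) = []
    unique-down (a , suc b) with parityAt a (suc b) ≟ℙ 1ℙ
    ... | yes _ = Unique.map⁺ ◅-injectiveʳ (pathsOfLength-unique k _ Q)
    ... | no  _ = []
    level-down : ∀ {p} → ¬ (p ∈ levelFirst k P Q × p ∈ downFirst k P Q)
    level-down (l , d) with () ← trans (sym (kind-level k P Q l)) (kind-down k P Q d)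
    up-rest : ∀ {p} → ¬ (p ∈ upFirst k P Q × p ∈ levelFirst k P Q ++ downFirst k P Q)
    up-rest (u , r) with ∈-++⁻ (levelFirst k P Q) r
    ... | inj₁ l with () ← trans (sym (kind-up k P Q u)) (kind-level k P Q l)
    ... | inj₂ d with () ← trans (sym (kind-up k P Q u)) (kind-down k P Q d)

gMot-complete : ∀ {P Q} (p : Path P Q) → p ∈ gMot P Q
gMot-complete {P} {Q} p with proj₁ Q ℤ.- proj₁ P | length-correct p
... | _ | refl = ∈-pathsOfLength p

gMot-unique : ∀ P Q → Unique (gMot P Q)
gMot-unique P Q with proj₁ Q ℤ.- proj₁ P
... | + k      = pathsOfLength-unique k P Q
... | -[1+ _ ] = []

module _ (α : ℕ → ℂ) where

  -- α₋ b is α_{b-1}, with α_{-1} = -1.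

  α₋ : ℕ → ℂ
  α₋ zero    = -ℂ 1ℂ
  α₋ (suc b) = α b

  stepWt : ∀ {P Q} → Step P Q → ℂ
  stepWt (up _ _ _)   = 1ℂ
  stepWt (down _ b _) = 1ℂ -ℂ ofℝ ∣ α₋ (suc b) ∣²
  stepWt (level a b) with parityAt a b
  ... | 0ℙ = α b
  ... | 1ℙ = -ℂ conj (α₋ b)

  wt : ∀ {P Q} → Path P Q → ℂ
  wt = fold (λ _ _ → ℂ) (λ s w → stepWt s *ℂ w) 1ℂ

{-# OPTIONS --safe #-}

-- Fix s, and let X j b and Y j b be the pairings of Φ_s with zʲΦ_b and zʲΦ*_b.
-- Under pairing, Szegő's recursion reads
--   zΦ_b = Φ_{b+1} + ᾱ_b Φ*_b ,   Φ*_b = (1 − |α_{b-1}|²) Φ*_{b-1} − α_{b-1} Φ_b ,   Φ*_0 = Φ_0 ,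
-- which are the steps of a gentle Motzkin path out of height b: a point (a , b) stands for
-- Φ_b when a + b is even and for Φ*_b when a + b is odd, a step multiplies by z exactly when
-- it leaves an even point, and the weights are conjugated because ⟨Φ_s , ·⟩ is conjugate linear.
-- Following all paths to (2n − s , s) expresses X n r as the sum of weights times ⟨Φ_s , Φ_s⟩;
-- paths that arrive at the wrong height or parity contribute nothing because Φ_s is orthogonal
-- to zʲΦ_b and zʲΦ*_b for 0 ≤ j and j + b < s, and similarly with Φ_s and Φ_b exchanged.  The same recursion gives
-- ⟨Φ_{s+1} , Φ_{s+1}⟩ = (1 − |α_s|²) ⟨Φ_s , Φ_s⟩, so the norms do not vanish.
module Submission where

open import Defs
open import Data.Nat.Base using (ℕ; zero; suc; parity)
open import Data.Integer.Base using (ℤ; +_; -[1+_])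
open import Data.List.Base using (List; []; _∷_; [_]; _++_; map)
open import Data.Product.Base using (Σ; _,_)
import Data.Integer.Base as ℤ
import Data.Nat.Base as ℕ
open import Algebra.Bundles using (AbelianGroup; CommutativeRing)
open import Algebra.Module.Construct.TensorUnit using (rawLeftModule)
open import Algebra.Module.Morphism.Structures using (module LeftModuleMorphisms)
open import Data.Empty using (⊥-elim)
import Data.Integer.Properties as ℤ
open import Data.Integer.Solver using () renaming (module +-*-Solver to ℤSolver)
open import Data.List.Properties using (map-++)
import Data.Nat.Properties as ℕ
open import Data.Nat.Solver using () renaming (module +-*-Solver to ℕSolver)
open import Data.Parity.Base using (0ℙ; 1ℙ; _⁻¹)
open import Data.Parity.Properties using (suc-homo-⁻¹; ⁻¹-selfInverse) renaming (_≟_ to _≟ℙ_)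
open import Data.Rational.Base as ℚ using (0ℚ; 1ℚ; ½; _<_; ∣_∣)
import Data.Rational.Properties as ℚ
open import Data.Rational.Solver using (module +-*-Solver)
open import Data.Sum.Base using (inj₁; inj₂)
open import Level using (0ℓ)
open import Relation.Binary.Construct.Closure.ReflexiveTransitive using (_◅_)
open import Relation.Binary.PropositionalEquality as ≡ using (_≡_; _≢_; cong; subst; subst₂)
open import Relation.Nullary using (yes; no)

-- Real and complex numbers

-- The difference vanishes at every index, so any `N` serves. Ring laws thereby reduce to identities
-- of rationals, index by index.
pointwise : ∀ {x y} → (∀ n → seq x n ≡ seq y n) → x ≈ℝ y
pointwise {x} {y} e = mk≈ℝ λ δ 0<δ → 0 , λ n _ →
  subst (_< δ) (≡.sym (≡.trans (cong (λ t → ∣ t ℚ.- seq y n ∣) (e n)) (cong ∣_∣ (ℚ.+-inverseʳ (seq y n))))) 0<δ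

symℝ : ∀ {x y} → x ≈ℝ y → y ≈ℝ x
symℝ {x} {y} (mk≈ℝ h) = mk≈ℝ λ δ 0<δ →
  let N , c = h δ 0<δ
  in N , λ n N≤n → subst (_< δ)
    (≡.trans (≡.sym (ℚ.∣-p∣≡∣p∣ (seq x n ℚ.- seq y n)))
             (cong ∣_∣ (solve 2 (λ a b → :- (a :- b) := b :- a) ≡.refl (seq x n) (seq y n))))
    (c n N≤n)
  where open +-*-Solver

transℝ : ∀ {x y z} → x ≈ℝ y → y ≈ℝ z → x ≈ℝ z
transℝ {x} {y} {z} (mk≈ℝ h) (mk≈ℝ k) = mk≈ℝ λ δ 0<δ →
  let M , c = h (½ ℚ.* δ) (*-pos 0<½ 0<δ)
      N , d = k (½ ℚ.* δ) (*-pos 0<½ 0<δ)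
  in M ℕ.⊔ N , λ n ≤n → subst₂ _<_
    (cong ∣_∣ (solve 3 (λ a b c → a :- b :+ (b :- c) := a :- c) ≡.refl (seq x n) (seq y n) (seq z n)))
    (half δ)
    (∣+∣-bound (seq x n ℚ.- seq y n) (seq y n ℚ.- seq z n) (c n (⊔-≤ˡ ≤n)) (d n (⊔-≤ʳ {M} ≤n)))
  where open +-*-Solver

+ℝ-cong : ∀ {x x′ y y′} → x ≈ℝ x′ → y ≈ℝ y′ → x +ℝ y ≈ℝ x′ +ℝ y′
+ℝ-cong {x} {x′} {y} {y′} (mk≈ℝ h) (mk≈ℝ k) = mk≈ℝ λ δ 0<δ →
  let M , c = h (½ ℚ.* δ) (*-pos 0<½ 0<δ)
      N , d = k (½ ℚ.* δ) (*-pos 0<½ 0<δ)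
  in M ℕ.⊔ N , λ n ≤n → subst₂ _<_
    (cong ∣_∣ (solve 4 (λ a a′ b b′ → a :- a′ :+ (b :- b′) := a :+ b :- (a′ :+ b′)) ≡.refl
                       (seq x n) (seq x′ n) (seq y n) (seq y′ n)))
    (half δ)
    (∣+∣-bound (seq x n ℚ.- seq x′ n) (seq y n ℚ.- seq y′ n) (c n (⊔-≤ˡ ≤n)) (d n (⊔-≤ʳ {M} ≤n)))
  where open +-*-Solver

-ℝ-cong : ∀ {x x′} → x ≈ℝ x′ → -ℝ x ≈ℝ -ℝ x′
-ℝ-cong {x} {x′} (mk≈ℝ h) = mk≈ℝ λ δ 0<δ →
  let N , c = h δ 0<δ
  in N , λ n N≤n → subst (_< δ)
    (≡.trans (≡.sym (ℚ.∣-p∣≡∣p∣ (seq x n ℚ.- seq x′ n)))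
             (cong ∣_∣ (solve 2 (λ a b → :- (a :- b) := :- a :- :- b) ≡.refl (seq x n) (seq x′ n))))
    (c n N≤n)
  where open +-*-Solver

-- Write xy - x′y′ = x(y - y′) + y′(x - x′). Eventually `B` bounds x and `C` bounds y′, and dividing
-- δ/2 by these bounds keeps each summand below δ/2.
*ℝ-cong : ∀ {x x′ y y′} → x ≈ℝ x′ → y ≈ℝ y′ → x *ℝ y ≈ℝ x′ *ℝ y′
*ℝ-cong {x} {x′} {y} {y′} (mk≈ℝ h) (mk≈ℝ k) = mk≈ℝ λ δ 0<δ →
  let B , 0<B , K , bx = bounded x
      C , 0<C , J , by = bounded y′
      M , hx = h (½ ℚ.* δ ℚ.* recip C) (*-pos (*-pos 0<½ 0<δ) (recip-pos C 0<C))
      N , hy = k (½ ℚ.* δ ℚ.* recip B) (*-pos (*-pos 0<½ 0<δ) (recip-pos B 0<B))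
  in (K ℕ.⊔ J) ℕ.⊔ (M ℕ.⊔ N) , λ n ≤n → subst₂ _<_
    (cong ∣_∣ (solve 4 (λ a a′ b b′ → a :* (b :- b′) :+ b′ :* (a :- a′) := a :* b :- a′ :* b′) ≡.refl
                       (seq x n) (seq x′ n) (seq y n) (seq y′ n)))
    (≡.trans (≡.cong₂ ℚ._+_ (cancel-bound B (½ ℚ.* δ) 0<B) (cancel-bound C (½ ℚ.* δ) 0<C)) (half δ))
    (∣+∣-bound (seq x n ℚ.* (seq y n ℚ.- seq y′ n)) (seq y′ n ℚ.* (seq x n ℚ.- seq x′ n))
      (∣∣-bound (seq x n) (seq y n ℚ.- seq y′ n)
        (bx n (⊔-≤ˡ (⊔-≤ˡ ≤n))) (hy n (⊔-≤ʳ {M} (⊔-≤ʳ {K ℕ.⊔ J} ≤n))))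
      (∣∣-bound (seq y′ n) (seq x n ℚ.- seq x′ n)
        (by n (⊔-≤ʳ {K} (⊔-≤ˡ ≤n))) (hx n (⊔-≤ˡ (⊔-≤ʳ {K ℕ.⊔ J} ≤n)))))
  where open +-*-Solver

-- If x stays above δ and y comes within δ/2 of x, then y stays above δ/2.
0<ℝ-resp : ∀ {x y} → x ≈ℝ y → 0ℝ <ℝ x → 0ℝ <ℝ y
0<ℝ-resp {x} {y} (mk≈ℝ h) (δ , 0<δ , M , δ<x) =
  let N , c = h (½ ℚ.* δ) (*-pos 0<½ 0<δ)
  in ½ ℚ.* δ , *-pos 0<½ 0<δ , M ℕ.⊔ N , λ n ≤n →
    subst₂ _<_ (solve 1 (λ a → (con 0ℚ :+ (con ½ :* a :+ con ½ :* a)) :- con ½ :* a := con 0ℚ :+ con ½ :* a) ≡.refl δ)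
               (solve 2 (λ a b → a :- (a :- b) := b) ≡.refl (seq x n) (seq y n))
      (ℚ.+-mono-< (subst (λ t → 0ℚ ℚ.+ t < seq x n) (≡.sym (half δ)) (δ<x n (⊔-≤ˡ ≤n)))
                  (ℚ.neg-antimono-< (ℚ.≤-<-trans (p≤∣p∣ _) (c n (⊔-≤ʳ {M} ≤n)))))
  where
  open +-*-Solver
  p≤∣p∣ : ∀ p → p ℚ.≤ ∣ p ∣
  p≤∣p∣ p with ℚ.≤-total 0ℚ p
  ... | inj₁ 0≤p = ℚ.≤-reflexive (≡.sym (ℚ.0≤p⇒∣p∣≡p 0≤p))
  ... | inj₂ p≤0 = ℚ.≤-trans p≤0 (ℚ.0≤∣p∣ p)

0<ℝ-* : ∀ {x y} → 0ℝ <ℝ x → 0ℝ <ℝ y → 0ℝ <ℝ x *ℝ y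
0<ℝ-* {x} {y} (δ , 0<δ , M , δ<x) (ε , 0<ε , N , ε<y) =
  δ ℚ.* ε , *-pos 0<δ 0<ε , M ℕ.⊔ N , λ n ≤n → bound (δ<x n (⊔-≤ˡ ≤n)) (ε<y n (⊔-≤ʳ {M} ≤n))
  where
  bound : ∀ {p q} → 0ℚ ℚ.+ δ < p → 0ℚ ℚ.+ ε < q → 0ℚ ℚ.+ δ ℚ.* ε < p ℚ.* q
  bound {p} {q} δ<p ε<q rewrite ℚ.+-identityˡ δ | ℚ.+-identityˡ ε | ℚ.+-identityˡ (δ ℚ.* ε) =
    ℚ.<-trans (ℚ.*-monoʳ-<-pos δ {{ℚ.positive 0<δ}} ε<q)
              (ℚ.*-monoˡ-<-pos q {{ℚ.positive (ℚ.<-trans 0<ε ε<q)}} δ<p)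

0<ℝ-1- : ∀ {x} → x <ℝ 1ℝ → 0ℝ <ℝ 1ℝ -ℝ x
0<ℝ-1- {x} (δ , 0<δ , N , x+δ<1) = δ , 0<δ , N , λ n N≤n →
  subst (_< 1ℚ ℚ.- seq x n) (solve 2 (λ a d → a :+ d :- a := con 0ℚ :+ d) ≡.refl (seq x n) δ)
    (ℚ.+-monoˡ-< (ℚ.- seq x n) (x+δ<1 n N≤n))
  where open +-*-Solver

-- Past `K` the terms of x are positive, so `recip` is a genuine inverse there and the product is
-- exactly 1.
inverseℝ-inverse : ∀ x (0<x : 0ℝ <ℝ x) → x *ℝ inverseℝ x 0<x ≈ℝ 1ℝ
inverseℝ-inverse x (d , 0<d , K , 0+d<x) = mk≈ℝ λ δ 0<δ → K , λ n K≤n →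
  subst (_< δ)
    (≡.sym (≡.trans (cong (λ t → ∣ t ℚ.- 1ℚ ∣) (recip-inverse (seq x n) (pos⇒≢0 (0<x n K≤n))))
                    (cong ∣_∣ (ℚ.+-inverseʳ 1ℚ))))
    0<δ
  where
  0<x : ∀ n → K ℕ.≤ n → 0ℚ < seq x n
  0<x n K≤n = ℚ.<-trans (subst (0ℚ <_) (≡.sym (ℚ.+-identityˡ d)) 0<d) (0+d<x n K≤n)

pointwiseℂ : ∀ {z w} → (∀ n → seq (re z) n ≡ seq (re w) n) → (∀ n → seq (im z) n ≡ seq (im w) n) → z ≈ℂ w
pointwiseℂ e f = mk≈ℂ (pointwise e) (pointwise f)

ℂ-commutativeRing : CommutativeRing 0ℓ 0ℓ
ℂ-commutativeRing = record
  { Carrier = ℂ ; _≈_ = _≈ℂ_ ; _+_ = _+ℂ_ ; _*_ = _*ℂ_ ; -_ = -ℂ_ ; 0# = 0ℂ ; 1# = 1ℂ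
  ; isCommutativeRing = record
    { isRing = record
      { +-isAbelianGroup = record
        { isGroup = record
          { isMonoid = record
            { isSemigroup = record
              { isMagma = record
                { isEquivalence = record
                  { refl  = pointwiseℂ (λ _ → ≡.refl) (λ _ → ≡.refl)
                  ; sym   = λ (mk≈ℂ p q) → mk≈ℂ (symℝ p) (symℝ q)
                  ; trans = λ (mk≈ℂ p q) (mk≈ℂ r s) → mk≈ℂ (transℝ p r) (transℝ q s)
                  }
                ; ∙-cong = λ (mk≈ℂ p q) (mk≈ℂ r s) → mk≈ℂ (+ℝ-cong p r) (+ℝ-cong q s)
                }
              ; assoc = λ x y z → pointwiseℂ
                  (λ n → ℚ.+-assoc (seq (re x) n) (seq (re y) n) (seq (re z) n))
                  (λ n → ℚ.+-assoc (seq (im x) n) (seq (im y) n) (seq (im z) n))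
              }
            ; identity =
                (λ x → pointwiseℂ (λ n → ℚ.+-identityˡ (seq (re x) n)) (λ n → ℚ.+-identityˡ (seq (im x) n)))
              , (λ x → pointwiseℂ (λ n → ℚ.+-identityʳ (seq (re x) n)) (λ n → ℚ.+-identityʳ (seq (im x) n)))
            }
          ; inverse =
              (λ x → pointwiseℂ (λ n → ℚ.+-inverseˡ (seq (re x) n)) (λ n → ℚ.+-inverseˡ (seq (im x) n)))
            , (λ x → pointwiseℂ (λ n → ℚ.+-inverseʳ (seq (re x) n)) (λ n → ℚ.+-inverseʳ (seq (im x) n)))
          ; ⁻¹-cong = λ (mk≈ℂ p q) → mk≈ℂ (-ℝ-cong p) (-ℝ-cong q)
          }
        ; comm = λ x y → pointwiseℂ (λ n → ℚ.+-comm (seq (re x) n) (seq (re y) n))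
                                    (λ n → ℚ.+-comm (seq (im x) n) (seq (im y) n))
        }
      ; *-cong = λ (mk≈ℂ p q) (mk≈ℂ r s) →
          mk≈ℂ (+ℝ-cong (*ℝ-cong p r) (-ℝ-cong (*ℝ-cong q s))) (+ℝ-cong (*ℝ-cong p s) (*ℝ-cong q r))
      ; *-assoc = λ x y z → pointwiseℂ
          (λ n → solve 6 (λ a b c d e f →
              (a :* c :- b :* d) :* e :- (a :* d :+ b :* c) :* f :=
              a :* (c :* e :- d :* f) :- b :* (c :* f :+ d :* e)) ≡.refl
            (seq (re x) n) (seq (im x) n) (seq (re y) n) (seq (im y) n) (seq (re z) n) (seq (im z) n))
          (λ n → solve 6 (λ a b c d e f →
              (a :* c :- b :* d) :* f :+ (a :* d :+ b :* c) :* e :=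
              a :* (c :* f :+ d :* e) :+ b :* (c :* e :- d :* f)) ≡.refl
            (seq (re x) n) (seq (im x) n) (seq (re y) n) (seq (im y) n) (seq (re z) n) (seq (im z) n))
      ; *-identity =
          (λ x → pointwiseℂ
            (λ n → solve 2 (λ a b → con 1ℚ :* a :- con 0ℚ :* b := a) ≡.refl (seq (re x) n) (seq (im x) n))
            (λ n → solve 2 (λ a b → con 1ℚ :* b :+ con 0ℚ :* a := b) ≡.refl (seq (re x) n) (seq (im x) n)))
        , (λ x → pointwiseℂ
            (λ n → solve 2 (λ a b → a :* con 1ℚ :- b :* con 0ℚ := a) ≡.refl (seq (re x) n) (seq (im x) n))
            (λ n → solve 2 (λ a b → a :* con 0ℚ :+ b :* con 1ℚ := b) ≡.refl (seq (re x) n) (seq (im x) n)))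
      ; distrib =
          (λ x y z → pointwiseℂ
            (λ n → solve 6 (λ a b c d e f →
                a :* (c :+ e) :- b :* (d :+ f) := (a :* c :- b :* d) :+ (a :* e :- b :* f)) ≡.refl
              (seq (re x) n) (seq (im x) n) (seq (re y) n) (seq (im y) n) (seq (re z) n) (seq (im z) n))
            (λ n → solve 6 (λ a b c d e f →
                a :* (d :+ f) :+ b :* (c :+ e) := (a :* d :+ b :* c) :+ (a :* f :+ b :* e)) ≡.refl
              (seq (re x) n) (seq (im x) n) (seq (re y) n) (seq (im y) n) (seq (re z) n) (seq (im z) n)))
        , (λ x y z → pointwiseℂ
            (λ n → solve 6 (λ a b c d e f →
                (c :+ e) :* a :- (d :+ f) :* b := (c :* a :- d :* b) :+ (e :* a :- f :* b)) ≡.refl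
              (seq (re x) n) (seq (im x) n) (seq (re y) n) (seq (im y) n) (seq (re z) n) (seq (im z) n))
            (λ n → solve 6 (λ a b c d e f →
                (c :+ e) :* b :+ (d :+ f) :* a := (c :* b :+ d :* a) :+ (e :* b :+ f :* a)) ≡.refl
              (seq (re x) n) (seq (im x) n) (seq (re y) n) (seq (im y) n) (seq (re z) n) (seq (im z) n)))
      }
    ; *-comm = λ x y → pointwiseℂ
        (λ n → solve 4 (λ a b c d → a :* c :- b :* d := c :* a :- d :* b) ≡.refl
          (seq (re x) n) (seq (im x) n) (seq (re y) n) (seq (im y) n))
        (λ n → solve 4 (λ a b c d → a :* d :+ b :* c := c :* b :+ d :* a) ≡.refl
          (seq (re x) n) (seq (im x) n) (seq (re y) n) (seq (im y) n))
    }
  }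
  where open +-*-Solver

private module C = CommutativeRing ℂ-commutativeRing
open import Algebra.Properties.AbelianGroup C.+-abelianGroup using (⁻¹-∙-comm)
open import Algebra.Properties.CommutativeSemigroup C.+-commutativeSemigroup using () renaming (interchange to +-interchange)
open import Algebra.Properties.CommutativeSemigroup C.*-commutativeSemigroup using () renaming (x∙yz≈y∙xz to *-swap)
open import Algebra.Properties.Group (AbelianGroup.group ℤ.+-0-abelianGroup) using () renaming (∙-cancelˡ to ℤ-+-cancelˡ)
open import Algebra.Properties.Ring C.ring using (-‿distribˡ-*; -‿distribʳ-*; -‿involutive; -0#≈0#)
open import Relation.Binary.Reasoning.Setoid C.setoid

-- Complex conjugation and division

conj-cong : ∀ {z w} → z ≈ℂ w → conj z ≈ℂ conj w
conj-cong (mk≈ℂ p q) = mk≈ℂ p (-ℝ-cong q)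

conj-+ : ∀ z w → conj (z +ℂ w) ≈ℂ conj z +ℂ conj w
conj-+ z w = pointwiseℂ (λ _ → ≡.refl) (λ n → ℚ.neg-distrib-+ (seq (im z) n) (seq (im w) n))

conj-0 : conj 0ℂ ≈ℂ 0ℂ
conj-0 = pointwiseℂ (λ _ → ≡.refl) (λ _ → ≡.refl)

conj-1 : conj 1ℂ ≈ℂ 1ℂ
conj-1 = pointwiseℂ (λ _ → ≡.refl) (λ _ → ≡.refl)

conj-* : ∀ z w → conj (z *ℂ w) ≈ℂ conj z *ℂ conj w
conj-* z w = pointwiseℂ
  (λ n → solve 4 (λ a b c d → a :* c :- b :* d := a :* c :- (:- b) :* (:- d)) ≡.refl
    (seq (re z) n) (seq (im z) n) (seq (re w) n) (seq (im w) n))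
  (λ n → solve 4 (λ a b c d → :- (a :* d :+ b :* c) := a :* (:- d) :+ (:- b) :* c) ≡.refl
    (seq (re z) n) (seq (im z) n) (seq (re w) n) (seq (im w) n))
  where open +-*-Solver

conj-involutive : ∀ z → conj (conj z) ≈ℂ z
conj-involutive z = pointwiseℂ (λ _ → ≡.refl) (λ n → solve 1 (λ b → :- (:- b) := b) ≡.refl (seq (im z) n))
  where open +-*-Solver

z*conj-z : ∀ z → z *ℂ conj z ≈ℂ ofℝ ∣ z ∣²
z*conj-z z = pointwiseℂ
  (λ n → solve 2 (λ a b → a :* a :- b :* (:- b) := a :* a :+ b :* b) ≡.refl (seq (re z) n) (seq (im z) n))
  (λ n → solve 2 (λ a b → a :* (:- b) :+ b :* a := con 0ℚ) ≡.refl (seq (re z) n) (seq (im z) n))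
  where open +-*-Solver

≈0⇒+*≈0 : ∀ {x y} c → x ≈ℂ 0ℂ → y ≈ℂ 0ℂ → x +ℂ c *ℂ y ≈ℂ 0ℂ
≈0⇒+*≈0 c x≈0 y≈0 = C.trans (C.+-cong x≈0 (C.trans (C.*-congˡ y≈0) (C.zeroʳ c))) (C.+-identityˡ 0ℂ)

≈0⇒-*≈0 : ∀ {x y} c → x ≈ℂ 0ℂ → y ≈ℂ 0ℂ → x -ℂ c *ℂ y ≈ℂ 0ℂ
≈0⇒-*≈0 c x≈0 y≈0 =
  C.trans (C.+-cong x≈0 (C.trans (C.-‿cong (C.trans (C.*-congˡ y≈0) (C.zeroʳ c))) -0#≈0#)) (C.+-identityˡ 0ℂ)

x-y+y≈x : ∀ x y → x -ℂ y +ℂ y ≈ℂ x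
x-y+y≈x x y = C.trans (C.+-assoc x (-ℂ y) y) (C.trans (C.+-congˡ (C.-‿inverseˡ y)) (C.+-identityʳ x))

ofℝ-cong : ∀ {x y} → x ≈ℝ y → ofℝ x ≈ℂ ofℝ y
ofℝ-cong x≈y = mk≈ℂ x≈y (pointwise (λ _ → ≡.refl))

ofℝ-* : ∀ x y → ofℝ x *ℂ ofℝ y ≈ℂ ofℝ (x *ℝ y)
ofℝ-* x y = pointwiseℂ
  (λ n → solve 2 (λ x y → x :* y :- con 0ℚ :* con 0ℚ := x :* y) ≡.refl (seq x n) (seq y n))
  (λ n → solve 2 (λ x y → x :* con 0ℚ :+ con 0ℚ :* y := con 0ℚ) ≡.refl (seq x n) (seq y n))
  where open +-*-Solver

#0-resp : ∀ {z w} → z ≈ℂ w → z #0 → w #0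
#0-resp (mk≈ℂ p q) = 0<ℝ-resp (+ℝ-cong (*ℝ-cong p p) (*ℝ-cong q q))

0<⇒ofℝ#0 : ∀ {x} → 0ℝ <ℝ x → ofℝ x #0
0<⇒ofℝ#0 {x} 0<x = 0<ℝ-resp {x *ℝ x} {∣ ofℝ x ∣²}
  (pointwise λ n → ≡.sym (ℚ.+-identityʳ (seq x n ℚ.* seq x n))) (0<ℝ-* {x} {x} 0<x 0<x)

-- With w = vz the quotient w z̄ / |z|² is v z z̄ / |z|², and z z̄ = |z|² cancels.
divide-≈ : ∀ {w v} z (z#0 : z #0) → v *ℂ z ≈ℂ w → divide w z z#0 ≈ℂ v
divide-≈ {w} {v} z z#0 vz≈w = begin
  w *ℂ conj z *ℂ z⁻²             ≈⟨ C.*-congʳ (C.*-congʳ vz≈w) ⟨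
  v *ℂ z *ℂ conj z *ℂ z⁻²        ≈⟨ C.*-congʳ (C.trans (C.*-assoc v z (conj z)) (C.*-congˡ (z*conj-z z))) ⟩
  v *ℂ ofℝ ∣ z ∣² *ℂ z⁻²         ≈⟨ C.trans (C.*-assoc v _ z⁻²) (C.*-congˡ (ofℝ-* ∣ z ∣² (inverseℝ ∣ z ∣² z#0))) ⟩
  v *ℂ ofℝ (∣ z ∣² *ℝ inverseℝ ∣ z ∣² z#0)
    ≈⟨ C.*-congˡ (ofℝ-cong (inverseℝ-inverse ∣ z ∣² z#0)) ⟩
  v *ℂ 1ℂ                        ≈⟨ C.*-identityʳ v ⟩
  v                              ∎
  where z⁻² = ofℝ (inverseℝ ∣ z ∣² z#0)

-- Linear functionals on Laurent polynomials

-- L f, expressed by the moments m k = L(zᵏ)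

ev : (ℤ → ℂ) → Laurent → ℂ
ev m []            = 0ℂ
ev m ((k , a) ∷ f) = a *ℂ m k +ℂ ev m f

ev-cong : ∀ {m m′} → (∀ k → m k ≈ℂ m′ k) → ∀ f → ev m f ≈ℂ ev m′ f
ev-cong e []            = C.refl
ev-cong e ((k , a) ∷ f) = C.+-cong (C.*-congˡ (e k)) (ev-cong e f)

ev-++ : ∀ m f g → ev m (f ++ g) ≈ℂ ev m f +ℂ ev m g
ev-++ m []            g = C.sym (C.+-identityˡ _)
ev-++ m ((k , a) ∷ f) g = C.trans (C.+-congˡ (ev-++ m f g)) (C.sym (C.+-assoc _ _ _))

ev-· : ∀ m c f → ev m (c · f) ≈ℂ c *ℂ ev m f
ev-· m c []            = C.sym (C.zeroʳ c)
ev-· m c ((k , a) ∷ f) =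
  C.trans (C.+-cong (C.*-assoc c a (m k)) (ev-· m c f)) (C.sym (C.distribˡ c _ _))

ev-neg : ∀ m f → ev m (-ᴸ f) ≈ℂ -ℂ ev m f
ev-neg m []            = C.sym -0#≈0#
ev-neg m ((k , a) ∷ f) =
  C.trans (C.+-cong (C.sym (-‿distribˡ-* a (m k))) (ev-neg m f)) (⁻¹-∙-comm _ _)

-- A functional of a product is a double sum over terms; nesting two evaluations lets each factor be
-- rewritten separately.
ev-*ᴸ : ∀ m f g → ev m (f *ᴸ g) ≈ℂ ev (λ j → ev (λ k → m (j ℤ.+ k)) g) f
ev-*ᴸ m []            g = C.refl
ev-*ᴸ m ((j , a) ∷ f) g = C.trans (ev-++ m (map _ g) (f *ᴸ g)) (C.+-cong (ev-term g) (ev-*ᴸ m f g))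
  where
  ev-term : ∀ g → ev m (map (λ (k , b) → j ℤ.+ k , a *ℂ b) g) ≈ℂ a *ℂ ev (λ k → m (j ℤ.+ k)) g
  ev-term []            = C.sym (C.zeroʳ a)
  ev-term ((k , b) ∷ g) = C.trans (C.+-cong (C.*-assoc a b _) (ev-term g)) (C.sym (C.distribˡ a _ _))

ev-z^ : ∀ m i → ev m (z^ i) ≈ℂ m i
ev-z^ m i = C.trans (C.+-identityʳ _) (C.*-identityˡ _)

ev-shift : ∀ m i f → ev m ((z^ i) *ᴸ f) ≈ℂ ev (λ k → m (i ℤ.+ k)) f
ev-shift m i f = C.trans (ev-*ᴸ m (z^ i) f) (ev-z^ (λ j → ev (λ k → m (j ℤ.+ k)) f) i)

ev-moments-0 : ∀ f → ev (λ _ → 0ℂ) f ≈ℂ 0ℂ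
ev-moments-0 []            = C.refl
ev-moments-0 ((k , a) ∷ f) = C.trans (C.+-cong (C.zeroʳ a) (ev-moments-0 f)) (C.+-identityˡ 0ℂ)

ev-moments-+ : ∀ m m′ f → ev (λ k → m k +ℂ m′ k) f ≈ℂ ev m f +ℂ ev m′ f
ev-moments-+ m m′ []            = C.sym (C.+-identityˡ 0ℂ)
ev-moments-+ m m′ ((k , a) ∷ f) =
  C.trans (C.+-cong (C.distribˡ a _ _) (ev-moments-+ m m′ f)) (+-interchange _ _ _ _)

ev-moments-* : ∀ c m f → ev (λ k → c *ℂ m k) f ≈ℂ c *ℂ ev m f
ev-moments-* c m []            = C.sym (C.zeroʳ c)
ev-moments-* c m ((k , a) ∷ f) =
  C.trans (C.+-cong (*-swap a c (m k)) (ev-moments-* c m f)) (C.sym (C.distribˡ c _ _))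

ev-moments-neg : ∀ m f → ev (λ k → -ℂ m k) f ≈ℂ -ℂ ev m f
ev-moments-neg m []            = C.sym -0#≈0#
ev-moments-neg m ((k , a) ∷ f) =
  C.trans (C.+-cong (C.sym (-‿distribʳ-* a (m k))) (ev-moments-neg m f)) (⁻¹-∙-comm _ _)

ev-swap : ∀ (m : ℤ → ℤ → ℂ) f g →
          ev (λ j → ev (λ k → m j k) g) f ≈ℂ ev (λ k → ev (λ j → m j k) f) g
ev-swap m []            g = C.sym (ev-moments-0 g)
ev-swap m ((j , a) ∷ f) g = begin
  a *ℂ ev (m j) g +ℂ ev (λ j → ev (m j) g) f
    ≈⟨ C.+-cong (C.sym (ev-moments-* a (m j) g)) (ev-swap m f g) ⟩
  ev (λ k → a *ℂ m j k) g +ℂ ev (λ k → ev (λ j → m j k) f) g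
    ≈⟨ ev-moments-+ _ _ g ⟨
  ev (λ k → ev (λ j → m j k) ((j , a) ∷ f)) g ∎

-- ⟨f , g⟩ = L(f · hat g)

hat : Laurent → Laurent
hat f = reflect (bar f)

-- `hat` conjugates coefficients and negates exponents. Conjugating the moments and then the whole
-- sum has the same effect and leaves `f` untouched, so identities for `f` itself apply inside.
ev-hat : ∀ m f → ev m (hat f) ≈ℂ conj (ev (λ k → conj (m (ℤ.- k))) f)
ev-hat m []            = C.sym conj-0
ev-hat m ((k , a) ∷ f) = begin
  conj a *ℂ m (ℤ.- k) +ℂ ev m (hat f)
    ≈⟨ C.+-cong (C.*-congˡ (C.sym (conj-involutive _))) (ev-hat m f) ⟩
  conj a *ℂ conj (conj (m (ℤ.- k))) +ℂ conj (ev m̃ f)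
    ≈⟨ C.+-congʳ (conj-* a _) ⟨
  conj (a *ℂ m̃ k) +ℂ conj (ev m̃ f)
    ≈⟨ conj-+ (a *ℂ m̃ k) (ev m̃ f) ⟨
  conj (a *ℂ m̃ k +ℂ ev m̃ f) ∎
  where m̃ = λ k → conj (m (ℤ.- k))

ev-hat-shift : ∀ m i f → ev m (hat ((z^ i) *ᴸ f)) ≈ℂ ev (λ k → m (ℤ.- i ℤ.+ k)) (hat f)
ev-hat-shift m i f = begin
  ev m (hat ((z^ i) *ᴸ f))
    ≈⟨ ev-hat m ((z^ i) *ᴸ f) ⟩
  conj (ev (λ k → conj (m (ℤ.- k))) ((z^ i) *ᴸ f))
    ≈⟨ conj-cong (ev-shift _ i f) ⟩
  conj (ev (λ k → conj (m (ℤ.- (i ℤ.+ k)))) f)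
    ≈⟨ conj-cong (ev-cong (λ k → C.reflexive (cong (λ t → conj (m t)) (ℤ.neg-distrib-+ i k))) f) ⟩
  conj (ev (λ k → conj (m (ℤ.- i ℤ.+ ℤ.- k))) f)
    ≈⟨ ev-hat _ f ⟨
  ev (λ k → m (ℤ.- i ℤ.+ k)) (hat f) ∎

ev-hat-hat : ∀ m f → ev m (hat (hat f)) ≈ℂ ev m f
ev-hat-hat m f = begin
  ev m (hat (hat f))
    ≈⟨ ev-hat m (hat f) ⟩
  conj (ev (λ k → conj (m (ℤ.- k))) (hat f))
    ≈⟨ conj-cong (ev-hat _ f) ⟩
  conj (conj (ev (λ k → conj (conj (m (ℤ.- (ℤ.- k))))) f))
    ≈⟨ conj-involutive _ ⟩
  ev (λ k → conj (conj (m (ℤ.- (ℤ.- k))))) f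
    ≈⟨ ev-cong (λ k → C.trans (conj-involutive _) (C.reflexive (cong m (ℤ.neg-involutive k)))) f ⟩
  ev m f ∎

ev-sub : ∀ m f c g → ev m (f -ᴸ c · g) ≈ℂ ev m f -ℂ c *ℂ ev m g
ev-sub m f c g = C.trans (ev-++ m f _) (C.+-congˡ (C.trans (ev-neg m (c · g)) (C.-‿cong (ev-· m c g))))

module _ (α : ℕ → ℂ) where

  -- Φₙ₊₁ = z Φₙ − ᾱₙ zⁿ Φ̂ₙ and Φ̂ₙ₊₁ = z⁻¹ Φ̂ₙ − αₙ z⁻ⁿ Φₙ, where Φ̂ₙ = hat Φₙ.

  ev-Φ-suc : ∀ m n → ev m (Φ α (suc n)) ≈ℂ
             ev (λ k → m (+ 1 ℤ.+ k)) (Φ α n) -ℂ conj (α n) *ℂ ev (λ k → m (+ n ℤ.+ k)) (hat (Φ α n))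
  ev-Φ-suc m n = C.trans (ev-sub m ((z^ (+ 1)) *ᴸ Φ α n) (conj (α n)) (star n (Φ α n)))
    (C.+-cong (ev-shift m (+ 1) (Φ α n)) (C.-‿cong (C.*-congˡ (ev-shift m (+ n) (hat (Φ α n))))))

  ev-Φ̂-suc : ∀ m n → ev m (hat (Φ α (suc n))) ≈ℂ
             ev (λ k → m (ℤ.- + 1 ℤ.+ k)) (hat (Φ α n)) -ℂ α n *ℂ ev (λ k → m (ℤ.- + n ℤ.+ k)) (Φ α n)
  ev-Φ̂-suc m n = begin
    ev m (hat (Φ α (suc n)))
      ≈⟨ ev-hat m (Φ α (suc n)) ⟩
    conj (ev m̃ (Φ α (suc n)))
      ≈⟨ conj-cong (ev-sub m̃ ((z^ (+ 1)) *ᴸ Φ α n) (conj (α n)) (star n (Φ α n))) ⟩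
    conj (ev m̃ ((z^ (+ 1)) *ᴸ Φ α n) -ℂ conj (α n) *ℂ ev m̃ (star n (Φ α n)))
      ≈⟨ conj-+ (ev m̃ ((z^ (+ 1)) *ᴸ Φ α n)) (-ℂ (conj (α n) *ℂ ev m̃ (star n (Φ α n)))) ⟩
    conj (ev m̃ ((z^ (+ 1)) *ᴸ Φ α n)) +ℂ -ℂ conj (conj (α n) *ℂ ev m̃ (star n (Φ α n)))
      ≈⟨ C.+-cong (C.sym (ev-hat m ((z^ (+ 1)) *ᴸ Φ α n)))
                  (C.-‿cong (C.trans (conj-* (conj (α n)) (ev m̃ (star n (Φ α n))))
                    (C.*-cong (conj-involutive (α n)) (C.sym (ev-hat m (star n (Φ α n))))))) ⟩
    ev m (hat ((z^ (+ 1)) *ᴸ Φ α n)) -ℂ α n *ℂ ev m (hat (star n (Φ α n)))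
      ≈⟨ C.+-cong (ev-hat-shift m (+ 1) (Φ α n))
           (C.-‿cong (C.*-congˡ (C.trans (ev-hat-shift m (+ n) (hat (Φ α n))) (ev-hat-hat _ (Φ α n))))) ⟩
    ev (λ k → m (ℤ.- + 1 ℤ.+ k)) (hat (Φ α n)) -ℂ α n *ℂ ev (λ k → m (ℤ.- + n ℤ.+ k)) (Φ α n) ∎
    where m̃ = λ k → conj (m (ℤ.- k))

  ev-Φ̂-zero : ∀ m → ev m (hat (Φ α 0)) ≈ℂ ev m (Φ α 0)
  ev-Φ̂-zero m = C.+-congʳ (C.*-congʳ conj-1)

module _ {L : Laurent → ℂ} (isLinear : IsLinearFunctional L) where
  open LeftModuleMorphisms Laurent-rawLeftModule (rawLeftModule {R = ℂ-rawRing})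
  open IsLeftModuleHomomorphism isLinear

  -- A Laurent polynomial is a concatenation of monomials. `L` respects equality of coefficients,
  -- which identifies the term (k , a) with a times zᵏ.
  functional≈ev : ∀ f → L f ≈ℂ ev (λ k → L (z^ k)) f
  functional≈ev []            = 0ᴹ-homo
  functional≈ev ((k , a) ∷ f) = C.trans (+ᴹ-homo [ k , a ] f)
    (C.+-cong (C.trans (⟦⟧-cong monomial) (*ₗ-homo a (z^ k))) (functional≈ev f))
    where
    monomial : [ k , a ] ≈ᴸ a · (z^ k)
    monomial i with k ℤ.≟ i
    ... | yes _ = C.+-congʳ (C.sym (C.*-identityʳ a))
    ... | no  _ = C.refl

-- Pairings of the orthogonal polynomials

-- Szegő's recurrences for a pairing of zʲΦ_b (as X j b) and zʲΦ*_b (as Y j b)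
-- with a fixed polynomial.

record Ladder (p q : ℕ → ℂ) (X Y : ℤ → ℕ → ℂ) : Set where
  field
    X-suc  : ∀ j b → X (ℤ.suc j) b ≈ℂ X j (suc b) +ℂ p b *ℂ Y j b
    Y-suc  : ∀ j b → Y j (suc b) ≈ℂ Y j b -ℂ q b *ℂ X (ℤ.suc j) b
    Y-zero : ∀ j → Y j 0 ≈ℂ X j 0

module _ {p q X Y} (ladder : Ladder p q X Y) (d : ℕ)
         (X₀≈0 : ∀ b → b ℕ.< d → X (+ 0) b ≈ℂ 0ℂ) where
  open Ladder ladder

  -- In the applications zʲΦ_b and zʲΦ*_b have degree at most j + b < d, so they lie in the span of
  -- Φ_0, ..., Φ_{d-1}. The recurrences give the vanishing without a basis expansion: a factor z is
  -- traded for one more unit of height.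
  X-vanish : ∀ j b → j ℕ.+ b ℕ.< d → X (+ j) b ≈ℂ 0ℂ
  Y-vanish : ∀ j b → j ℕ.+ b ℕ.< d → Y (+ j) b ≈ℂ 0ℂ
  X-vanish zero    b lt = X₀≈0 b lt
  X-vanish (suc j) b lt = C.trans (X-suc (+ j) b)
    (≈0⇒+*≈0 (p b) (X-vanish j (suc b) (≡.subst (ℕ._< d) (≡.sym (ℕ.+-suc j b)) lt))
                   (Y-vanish j b (ℕ.<-trans (ℕ.n<1+n _) lt)))
  Y-vanish j zero    lt = C.trans (Y-zero (+ j)) (X-vanish j 0 lt)
  Y-vanish j (suc b) lt = C.trans (Y-suc (+ j) b)
    -- Expanding `X` at j + 1 on the spot keeps the first index from growing, so the mutual
    -- recursion is structural.
    (≈0⇒-*≈0 (q b) Yⱼ≈0 (C.trans (X-suc (+ j) b) (≈0⇒+*≈0 (p b) (X-vanish j (suc b) lt) Yⱼ≈0)))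
    where Yⱼ≈0 = Y-vanish j b (ℕ.<-trans (ℕ.+-monoʳ-< j (ℕ.n<1+n b)) lt)

module _ (m : ℤ → ℂ) where

  -- L(zʲ f g)
  pair : ℤ → Laurent → Laurent → ℂ
  pair j f g = ev (λ k → ev (λ l → m (j ℤ.+ (k ℤ.+ l))) g) f

  pair-index : ∀ {i j} f g → i ≡ j → pair i f g ≈ℂ pair j f g
  pair-index f g ≡.refl = C.refl

  pair-sym : ∀ j f g → pair j f g ≈ℂ pair j g f
  pair-sym j f g = C.trans (ev-swap (λ k l → m (j ℤ.+ (k ℤ.+ l))) f g)
    (ev-cong (λ l → ev-cong (λ k → C.reflexive (cong (λ t → m (j ℤ.+ t)) (ℤ.+-comm k l))) f) g)

  -- The recurrence is required for all moment sequences because it is applied once for each term zᵏ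
  -- of `f`, to moments shifted by j + k; linearity then sums over the terms.
  pair-recurrence : ∀ {g g₁ g₂ c i₁ i₂} →
    (∀ m → ev m g ≈ℂ ev (λ k → m (i₁ ℤ.+ k)) g₁ -ℂ c *ℂ ev (λ k → m (i₂ ℤ.+ k)) g₂) →
    ∀ j f → pair j f g ≈ℂ pair (j ℤ.+ i₁) f g₁ -ℂ c *ℂ pair (j ℤ.+ i₂) f g₂
  pair-recurrence {g} {g₁} {g₂} {c} {i₁} {i₂} rec j f = begin
    ev (λ k → ev (λ l → m (j ℤ.+ (k ℤ.+ l))) g) f
      ≈⟨ ev-cong (λ k → C.trans (rec (λ l → m (j ℤ.+ (k ℤ.+ l))))
           (C.+-cong (reindex i₁ g₁ k) (C.-‿cong (C.*-congˡ (reindex i₂ g₂ k))))) f ⟩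
    ev (λ k → E₁ k -ℂ c *ℂ E₂ k) f
      ≈⟨ ev-moments-+ E₁ (λ k → -ℂ (c *ℂ E₂ k)) f ⟩
    ev E₁ f +ℂ ev (λ k → -ℂ (c *ℂ E₂ k)) f
      ≈⟨ C.+-congˡ (C.trans (ev-moments-neg (λ k → c *ℂ E₂ k) f) (C.-‿cong (ev-moments-* c E₂ f))) ⟩
    ev E₁ f -ℂ c *ℂ ev E₂ f ∎
    where
    E : ℤ → Laurent → ℤ → ℂ
    E i g k = ev (λ l → m (j ℤ.+ i ℤ.+ (k ℤ.+ l))) g
    E₁ = E i₁ g₁
    E₂ = E i₂ g₂
    open ℤSolver
    reindex : ∀ i g k → ev (λ l → m (j ℤ.+ (k ℤ.+ (i ℤ.+ l)))) g ≈ℂ E i g k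
    reindex i g k = ev-cong (λ l → C.reflexive (cong m
      (solve 4 (λ j k i l → j :+ (k :+ (i :+ l)) := j :+ i :+ (k :+ l)) ≡.refl j k i l))) g

  module _ (α : ℕ → ℂ) where

    Φ̂ : ℕ → Laurent
    Φ̂ n = hat (Φ α n)

    pair-Φ-suc : ∀ j f b → pair j f (Φ α (suc b)) ≈ℂ
                 pair (j ℤ.+ + 1) f (Φ α b) -ℂ conj (α b) *ℂ pair (j ℤ.+ + b) f (Φ̂ b)
    pair-Φ-suc j f b = pair-recurrence (λ m → ev-Φ-suc α m b) j f

    pair-Φ̂-suc : ∀ j f b → pair j f (Φ̂ (suc b)) ≈ℂ
                 pair (j ℤ.+ ℤ.- + 1) f (Φ̂ b) -ℂ α b *ℂ pair (j ℤ.+ ℤ.- + b) f (Φ α b)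
    pair-Φ̂-suc j f b = pair-recurrence (λ m → ev-Φ̂-suc α m b) j f

    pair-zero : ∀ j f → pair j f (Φ̂ 0) ≈ℂ pair j f (Φ α 0)
    pair-zero j f = ev-cong (λ k → ev-Φ̂-zero α (λ l → m (j ℤ.+ (k ℤ.+ l)))) f

    -- ⟨Φ_d , zʲΦ_b⟩ , ⟨Φ_d , zʲΦ*_b⟩ , ⟨zʲΦ_b , Φ_d⟩ and ⟨zʲΦ*_b , Φ_d⟩
    Xᵣ Yᵣ Xₗ Yₗ : ℕ → ℤ → ℕ → ℂ
    Xᵣ d j b = pair (ℤ.- j) (Φ α d) (Φ̂ b)
    Yᵣ d j b = pair (ℤ.- j ℤ.+ ℤ.- + b) (Φ α d) (Φ α b)
    Xₗ d j b = pair j (Φ̂ d) (Φ α b)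
    Yₗ d j b = pair (j ℤ.+ + b) (Φ̂ d) (Φ̂ b)

    -- The varying polynomial sits in the conjugated slot, so `hat` turns zʲ into z⁻ʲ, Φ*_b = zᵇΦ̂_b
    -- into z⁻ᵇΦ_b, and the coefficients of Szegő's recurrences into their conjugates.
    ladderᵣ : ∀ d → Ladder α (λ b → conj (α b)) (Xᵣ d) (Yᵣ d)
    ladderᵣ d = record
      { X-suc = λ j b → begin
          Xᵣ d (ℤ.suc j) b
            ≈⟨ pair-index (Φ α d) (Φ̂ b) (solve 1 (λ j → :- (con (+ 1) :+ j) := :- j :+ con -[1+ 0 ]) ≡.refl j) ⟩
          pair (ℤ.- j ℤ.+ ℤ.- + 1) (Φ α d) (Φ̂ b)
            ≈⟨ x-y+y≈x _ (α b *ℂ Yᵣ d j b) ⟨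
          pair (ℤ.- j ℤ.+ ℤ.- + 1) (Φ α d) (Φ̂ b) -ℂ α b *ℂ Yᵣ d j b +ℂ α b *ℂ Yᵣ d j b
            ≈⟨ C.+-congʳ (C.sym (pair-Φ̂-suc (ℤ.- j) (Φ α d) b)) ⟩
          Xᵣ d j (suc b) +ℂ α b *ℂ Yᵣ d j b ∎
      ; Y-suc = λ j b → C.trans (pair-Φ-suc (ℤ.- j ℤ.+ ℤ.- + suc b) (Φ α d) b)
          (C.+-cong
            (pair-index (Φ α d) (Φ α b)
              (solve 2 (λ j b → :- j :+ :- (con (+ 1) :+ b) :+ con (+ 1) := :- j :+ :- b) ≡.refl j (+ b)))
            (C.-‿cong (C.*-congˡ (pair-index (Φ α d) (Φ̂ b)
              (solve 2 (λ j b → :- j :+ :- (con (+ 1) :+ b) :+ b := :- (con (+ 1) :+ j)) ≡.refl j (+ b))))))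
      ; Y-zero = λ j → C.trans (pair-index (Φ α d) (Φ α 0) (ℤ.+-identityʳ (ℤ.- j))) (C.sym (pair-zero (ℤ.- j) (Φ α d)))
      }
      where open ℤSolver

    -- The varying polynomial now sits in the linear slot, so the recurrences keep their own
    -- coefficients.
    ladderₗ : ∀ d → Ladder (λ b → conj (α b)) α (Xₗ d) (Yₗ d)
    ladderₗ d = record
      { X-suc = λ j b → begin
          Xₗ d (ℤ.suc j) b
            ≈⟨ pair-index (Φ̂ d) (Φ α b) (ℤ.+-comm (+ 1) j) ⟩
          pair (j ℤ.+ + 1) (Φ̂ d) (Φ α b)
            ≈⟨ x-y+y≈x _ (conj (α b) *ℂ Yₗ d j b) ⟨
          pair (j ℤ.+ + 1) (Φ̂ d) (Φ α b) -ℂ conj (α b) *ℂ Yₗ d j b +ℂ conj (α b) *ℂ Yₗ d j b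
            ≈⟨ C.+-congʳ (C.sym (pair-Φ-suc j (Φ̂ d) b)) ⟩
          Xₗ d j (suc b) +ℂ conj (α b) *ℂ Yₗ d j b ∎
      ; Y-suc = λ j b → C.trans (pair-Φ̂-suc (j ℤ.+ + suc b) (Φ̂ d) b)
          (C.+-cong
            (pair-index (Φ̂ d) (Φ̂ b)
              (solve 2 (λ j b → j :+ (con (+ 1) :+ b) :+ con -[1+ 0 ] := j :+ b) ≡.refl j (+ b)))
            (C.-‿cong (C.*-congˡ (pair-index (Φ̂ d) (Φ α b)
              (solve 2 (λ j b → j :+ (con (+ 1) :+ b) :+ :- b := con (+ 1) :+ j) ≡.refl j (+ b))))))
      ; Y-zero = λ j → C.trans (pair-index (Φ̂ d) (Φ̂ 0) (ℤ.+-identityʳ j)) (pair-zero j (Φ̂ d))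
      }
      where open ℤSolver

    -- The squared norm ⟨Φ_d , Φ_d⟩.
    κ : ℕ → ℂ
    κ d = pair (+ 0) (Φ α d) (Φ̂ d)

    -- Vanishing pairings and the recursion for the norms

    module _ (orthogonal : ∀ d b → d ≢ b → pair (+ 0) (Φ α d) (Φ̂ b) ≈ℂ 0ℂ) where

      Xᵣ-vanish : ∀ d j b → j ℕ.+ b ℕ.< d → Xᵣ d (+ j) b ≈ℂ 0ℂ
      Xᵣ-vanish d = X-vanish (ladderᵣ d) d (λ b b<d → orthogonal d b (λ e → ℕ.<⇒≢ b<d (≡.sym e)))

      Yᵣ-vanish : ∀ d j b → j ℕ.+ b ℕ.< d → Yᵣ d (+ j) b ≈ℂ 0ℂ
      Yᵣ-vanish d = Y-vanish (ladderᵣ d) d (λ b b<d → orthogonal d b (λ e → ℕ.<⇒≢ b<d (≡.sym e)))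

      Xₗ₀≈0 : ∀ d b → b ℕ.< d → Xₗ d (+ 0) b ≈ℂ 0ℂ
      Xₗ₀≈0 d b b<d = C.trans (pair-sym (+ 0) (Φ̂ d) (Φ α b)) (orthogonal b d (ℕ.<⇒≢ b<d))

      Xₗ-vanish : ∀ d j b → j ℕ.+ b ℕ.< d → Xₗ d (+ j) b ≈ℂ 0ℂ
      Xₗ-vanish d = X-vanish (ladderₗ d) d (Xₗ₀≈0 d)

      Yₗ-vanish : ∀ d j b → j ℕ.+ b ℕ.< d → Yₗ d (+ j) b ≈ℂ 0ℂ
      Yₗ-vanish d = Y-vanish (ladderₗ d) d (Xₗ₀≈0 d)

      κ-sym : ∀ d → pair (+ 0) (Φ̂ d) (Φ α d) ≈ℂ κ d
      κ-sym d = pair-sym (+ 0) (Φ̂ d) (Φ α d)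

      -- This is ⟨Φ*_d , zΦ_d⟩ = α_d ⟨Φ_d , Φ_d⟩. It follows by expanding Φ_{d+1} in ⟨Φ*_d ,
      -- Φ_{d+1}⟩, which is 0 because Φ*_d has degree at most d.
      pair-Φ̂-Φ̂ : ∀ d → pair (-[1+ 0 ] ℤ.+ + d) (Φ̂ d) (Φ̂ d) ≈ℂ α d *ℂ κ d
      pair-Φ̂-Φ̂ d = begin
        P
          ≈⟨ x-y+y≈x P (α d *ℂ κ d) ⟨
        P -ℂ α d *ℂ κ d +ℂ α d *ℂ κ d
          ≈⟨ C.+-congʳ (C.+-cong (pair-index (Φ̂ d) (Φ̂ d) (ℤ.+-comm -[1+ 0 ] (+ d)))
               (C.-‿cong (C.*-congˡ (C.trans (C.sym (κ-sym d))
                 (pair-index (Φ̂ d) (Φ α d) (≡.sym (ℤ.+-inverseʳ (+ d)))))))) ⟩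
        pair (+ d ℤ.+ ℤ.- + 1) (Φ̂ d) (Φ̂ d) -ℂ α d *ℂ pair (+ d ℤ.+ ℤ.- + d) (Φ̂ d) (Φ α d) +ℂ α d *ℂ κ d
          ≈⟨ C.+-congʳ (C.sym (pair-Φ̂-suc (+ d) (Φ̂ d) d)) ⟩
        pair (+ d) (Φ̂ d) (Φ̂ (suc d)) +ℂ α d *ℂ κ d
          ≈⟨ C.+-congʳ (C.trans (pair-sym (+ d) (Φ̂ d) (Φ̂ (suc d))) (Yₗ-vanish (suc d) 0 d (ℕ.n<1+n d))) ⟩
        0ℂ +ℂ α d *ℂ κ d
          ≈⟨ C.+-identityˡ _ ⟩
        α d *ℂ κ d ∎
        where P = pair (-[1+ 0 ] ℤ.+ + d) (Φ̂ d) (Φ̂ d)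

      -- Since ⟨Φ_{d+1} , Φ*_d⟩ = 0, the squared norm equals ⟨Φ_{d+1} , zΦ_d⟩. Expanding Φ_{d+1} in
      -- the first slot leaves ⟨Φ_d , Φ_d⟩ - ᾱ_d ⟨Φ*_d , zΦ_d⟩.
      κ-suc : ∀ d → κ (suc d) ≈ℂ (1ℂ -ℂ ofℝ ∣ α d ∣²) *ℂ κ d
      κ-suc d = begin
        Xᵣ (suc d) (+ 0) (suc d)
          ≈⟨ C.+-identityʳ _ ⟨
        Xᵣ (suc d) (+ 0) (suc d) +ℂ 0ℂ
          ≈⟨ C.+-congˡ (C.trans (C.*-congˡ (Yᵣ-vanish (suc d) 0 d (ℕ.n<1+n d))) (C.zeroʳ (α d))) ⟨
        Xᵣ (suc d) (+ 0) (suc d) +ℂ α d *ℂ Yᵣ (suc d) (+ 0) d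
          ≈⟨ Ladder.X-suc (ladderᵣ (suc d)) (+ 0) d ⟨
        pair -[1+ 0 ] (Φ α (suc d)) (Φ̂ d)
          ≈⟨ pair-sym -[1+ 0 ] (Φ α (suc d)) (Φ̂ d) ⟩
        pair -[1+ 0 ] (Φ̂ d) (Φ α (suc d))
          ≈⟨ pair-Φ-suc -[1+ 0 ] (Φ̂ d) d ⟩
        pair (+ 0) (Φ̂ d) (Φ α d) -ℂ conj (α d) *ℂ pair (-[1+ 0 ] ℤ.+ + d) (Φ̂ d) (Φ̂ d)
          ≈⟨ C.+-cong (κ-sym d) (C.-‿cong (C.*-congˡ (pair-Φ̂-Φ̂ d))) ⟩
        κ d -ℂ conj (α d) *ℂ (α d *ℂ κ d)
          ≈⟨ C.+-cong (C.sym (C.*-identityˡ (κ d))) (C.-‿cong (C.sym (C.*-assoc (conj (α d)) (α d) (κ d)))) ⟩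
        1ℂ *ℂ κ d -ℂ conj (α d) *ℂ α d *ℂ κ d
          ≈⟨ C.+-congˡ (C.-‿cong (C.*-congʳ (C.trans (C.*-comm (conj (α d)) (α d)) (z*conj-z (α d))))) ⟩
        1ℂ *ℂ κ d -ℂ ofℝ ∣ α d ∣² *ℂ κ d
          ≈⟨ C.+-congˡ (-‿distribˡ-* (ofℝ ∣ α d ∣²) (κ d)) ⟩
        1ℂ *ℂ κ d +ℂ (-ℂ ofℝ ∣ α d ∣²) *ℂ κ d
          ≈⟨ C.distribʳ (κ d) 1ℂ (-ℂ ofℝ ∣ α d ∣²) ⟨
        (1ℂ -ℂ ofℝ ∣ α d ∣²) *ℂ κ d ∎

-- Gentle Motzkin paths

parity-ℤsuc : ∀ i → parity ℤ.∣ ℤ.suc i ∣ ≡ (parity ℤ.∣ i ∣) ⁻¹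
parity-ℤsuc (+ n)        = ≡.sym (⁻¹-selfInverse (suc-homo-⁻¹ n))
parity-ℤsuc -[1+ zero ]  = ≡.refl
parity-ℤsuc -[1+ suc n ] = ≡.sym (suc-homo-⁻¹ (suc n))

parityAt-sucˡ : ∀ a b → parityAt (ℤ.suc a) b ≡ parityAt a b ⁻¹
parityAt-sucˡ a b = ≡.trans (cong (λ i → parity ℤ.∣ i ∣) (ℤ.+-assoc (+ 1) a (+ b))) (parity-ℤsuc (a ℤ.+ + b))

parityAt-sucʳ : ∀ a b → parityAt a (suc b) ≡ parityAt a b ⁻¹
parityAt-sucʳ a b = ≡.trans (cong (λ i → parity ℤ.∣ i ∣) (≡.trans e (ℤ.+-assoc (+ 1) a (+ b)))) (parity-ℤsuc (a ℤ.+ + b))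
  where
  open ℤSolver
  e : a ℤ.+ + suc b ≡ ℤ.suc a ℤ.+ + b
  e = solve 2 (λ a b → a :+ (con (+ 1) :+ b) := con (+ 1) :+ a :+ b) ≡.refl a (+ b)

∑-++ : ∀ xs ys → ∑ (xs ++ ys) ≈ℂ ∑ xs +ℂ ∑ ys
∑-++ []       ys = C.sym (C.+-identityˡ _)
∑-++ (x ∷ xs) ys = C.trans (C.+-congˡ (∑-++ xs ys)) (C.sym (C.+-assoc x _ _))

combine-* : ∀ s w t w′ κ {x x′} → w *ℂ κ ≈ℂ x → w′ *ℂ κ ≈ℂ x′ →
                 (s *ℂ w +ℂ t *ℂ w′) *ℂ κ ≈ℂ s *ℂ x +ℂ t *ℂ x′
combine-* s w t w′ κ wκ w′κ = C.trans (C.distribʳ κ (s *ℂ w) (t *ℂ w′))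
  (C.+-cong (C.trans (C.*-assoc s w κ) (C.*-congˡ wκ)) (C.trans (C.*-assoc t w′ κ) (C.*-congˡ w′κ)))

-- Path weights, split by the first step

module _ (α : ℕ → ℂ) where

  ∑wt : ∀ {P Q} → List (Path P Q) → ℂ
  ∑wt ps = ∑ (map (wt α) ps)

  ∑wt-++ : ∀ {P Q} (ps qs : List (Path P Q)) → ∑wt (ps ++ qs) ≈ℂ ∑wt ps +ℂ ∑wt qs
  ∑wt-++ ps qs = C.trans (C.reflexive (cong ∑ (map-++ (wt α) ps qs))) (∑-++ (map (wt α) ps) (map (wt α) qs))

  ∑wt-◅ : ∀ {P Q R} (s : Step P Q) (ps : List (Path Q R)) → ∑wt (map (s ◅_) ps) ≈ℂ stepWt α s *ℂ ∑wt ps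
  ∑wt-◅ s []       = C.sym (C.zeroʳ _)
  ∑wt-◅ s (p ∷ ps) = C.trans (C.+-congˡ (∑wt-◅ s ps)) (C.sym (C.distribˡ (stepWt α s) (wt α p) (∑wt ps)))

  W : ℕ → Point → Point → ℂ
  W k P Q = ∑wt (pathsOfLength k P Q)

  module _ (k : ℕ) (a : ℤ) (b : ℕ) (Q : Point) where

    ∑wt-upFirst-even : parityAt a b ≡ 0ℙ → ∑wt (upFirst k (a , b) Q) ≈ℂ W k (ℤ.suc a , suc b) Q
    ∑wt-upFirst-even e with parityAt a b ≟ℙ 0ℙ
    ... | yes e′ = C.trans (∑wt-◅ (up a b e′) (pathsOfLength k _ Q)) (C.*-identityˡ _)
    ... | no  ¬e = ⊥-elim (¬e e)

    ∑wt-upFirst-odd : parityAt a b ≡ 1ℙ → ∑wt (upFirst k (a , b) Q) ≈ℂ 0ℂ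
    ∑wt-upFirst-odd o with parityAt a b ≟ℙ 0ℙ
    ... | yes e with () ← ≡.trans (≡.sym o) e
    ... | no  _ = C.refl

    ∑wt-levelFirst : ∑wt (levelFirst k (a , b) Q) ≈ℂ stepWt α (level a b) *ℂ W k (ℤ.suc a , b) Q
    ∑wt-levelFirst = ∑wt-◅ (level a b) (pathsOfLength k _ Q)

    ∑wt-downFirst-odd : parityAt a (suc b) ≡ 1ℙ →
      ∑wt (downFirst k (a , suc b) Q) ≈ℂ (1ℂ -ℂ ofℝ ∣ α b ∣²) *ℂ W k (ℤ.suc a , b) Q
    ∑wt-downFirst-odd o with parityAt a (suc b) ≟ℙ 1ℙ
    ... | yes o′ = ∑wt-◅ (down a b o′) (pathsOfLength k _ Q)
    ... | no  ¬o = ⊥-elim (¬o o)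

  ∑wt-downFirst-even : ∀ k a b Q → parityAt a b ≡ 0ℙ → ∑wt (downFirst k (a , b) Q) ≈ℂ 0ℂ
  ∑wt-downFirst-even k a zero    Q e = C.refl
  ∑wt-downFirst-even k a (suc b) Q e with parityAt a (suc b) ≟ℙ 1ℙ
  ... | yes o with () ← ≡.trans (≡.sym o) e
  ... | no  _ = C.refl

  stepWt-level-even : ∀ a b → parityAt a b ≡ 0ℙ → stepWt α (level a b) ≡ α b
  stepWt-level-even a b e rewrite e = ≡.refl

  stepWt-level-odd : ∀ a b → parityAt a b ≡ 1ℙ → stepWt α (level a b) ≡ -ℂ conj (α₋ α b)
  stepWt-level-odd a b o rewrite o = ≡.refl

  W-suc : ∀ k a b Q → W (suc k) (a , b) Q ≈ℂ
    ∑wt (upFirst k (a , b) Q) +ℂ (∑wt (levelFirst k (a , b) Q) +ℂ ∑wt (downFirst k (a , b) Q))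
  W-suc k a b Q = C.trans (∑wt-++ (upFirst k (a , b) Q) _) (C.+-congˡ (∑wt-++ (levelFirst k (a , b) Q) _))

  -- At an even point no down-step is allowed, and the up-step has weight 1.
  W-suc-even : ∀ k a b Q → parityAt a b ≡ 0ℙ →
    W (suc k) (a , b) Q ≈ℂ W k (ℤ.suc a , suc b) Q +ℂ α b *ℂ W k (ℤ.suc a , b) Q
  W-suc-even k a b Q e = C.trans (W-suc k a b Q) (C.+-cong (∑wt-upFirst-even k a b Q e)
    (C.trans (C.+-cong (C.trans (∑wt-levelFirst k a b Q) (C.*-congʳ (C.reflexive (stepWt-level-even a b e))))
                       (∑wt-downFirst-even k a b Q e))
             (C.+-identityʳ _)))

  W-suc-odd-zero : ∀ k a Q → parityAt a 0 ≡ 1ℙ → W (suc k) (a , 0) Q ≈ℂ W k (ℤ.suc a , 0) Q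
  W-suc-odd-zero k a Q o = begin
    W (suc k) (a , 0) Q
      ≈⟨ W-suc k a 0 Q ⟩
    ∑wt (upFirst k (a , 0) Q) +ℂ (∑wt (levelFirst k (a , 0) Q) +ℂ 0ℂ)
      ≈⟨ C.+-cong (∑wt-upFirst-odd k a 0 Q o) (C.+-identityʳ _) ⟩
    0ℂ +ℂ ∑wt (levelFirst k (a , 0) Q)
      ≈⟨ C.trans (C.+-identityˡ _) (∑wt-levelFirst k a 0 Q) ⟩
    stepWt α (level a 0) *ℂ W k (ℤ.suc a , 0) Q
      ≈⟨ C.*-congʳ (C.trans (C.reflexive (stepWt-level-odd a 0 o))
           (C.trans (C.-‿cong (C.-‿cong conj-1)) (-‿involutive 1ℂ))) ⟩
    1ℂ *ℂ W k (ℤ.suc a , 0) Q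
      ≈⟨ C.*-identityˡ _ ⟩
    W k (ℤ.suc a , 0) Q ∎

  W-suc-odd-suc : ∀ k a b Q → parityAt a (suc b) ≡ 1ℙ →
    W (suc k) (a , suc b) Q ≈ℂ
      (-ℂ conj (α b)) *ℂ W k (ℤ.suc a , suc b) Q +ℂ (1ℂ -ℂ ofℝ ∣ α b ∣²) *ℂ W k (ℤ.suc a , b) Q
  W-suc-odd-suc k a b Q o = C.trans (W-suc k a (suc b) Q) (C.trans
    (C.+-cong (∑wt-upFirst-odd k a (suc b) Q o)
      (C.+-cong (C.trans (∑wt-levelFirst k a (suc b) Q) (C.*-congʳ (C.reflexive (stepWt-level-odd a (suc b) o))))
                (∑wt-downFirst-odd k a b Q o)))
    (C.+-identityˡ _))

  -- A path from (a , b) to (c , d) still has to multiply by zʲ: it starts at Φ_b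
  -- when a + b is even and at Φ*_b when a + b is odd.

  module _ {X Y} (ladder : Ladder α (λ b → conj (α b)) X Y) (c : ℤ) (d : ℕ)
           (X-base : ∀ j b → + b ℤ.+ (j ℤ.+ j) ≡ + d → b ≢ d → X j b ≈ℂ 0ℂ)
           (Y-base : ∀ j b → ℤ.suc (+ b ℤ.+ (j ℤ.+ j)) ≡ + d → Y j b ≈ℂ 0ℂ) where
    open Ladder ladder

    -- Induction on the number k of steps left. The invariant is b + 2j = d + k at even points and b
    -- + 2j + 1 = d + k at odd ones: a step out of an even point lowers j by one, a step out of an
    -- odd point keeps j.
    W-even : ∀ k a b j → parityAt a b ≡ 0ℙ → + b ℤ.+ (j ℤ.+ j) ≡ + d ℤ.+ + k → a ℤ.+ + k ≡ c →
             W k (a , b) (c , d) *ℂ X (+ 0) d ≈ℂ X j b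
    W-odd  : ∀ k a b j → parityAt a b ≡ 1ℙ → ℤ.suc (+ b ℤ.+ (j ℤ.+ j)) ≡ + d ℤ.+ + k → a ℤ.+ + k ≡ c →
             W k (a , b) (c , d) *ℂ X (+ 0) d ≈ℂ Y j b

    private
      next : ∀ {k a} → a ℤ.+ + suc k ≡ c → ℤ.suc a ℤ.+ + k ≡ c
      next {k} {a} = ≡.trans (solve 2 (λ a k → con (+ 1) :+ a :+ k := a :+ (con (+ 1) :+ k)) ≡.refl a (+ k))
        where open ℤSolver

    -- Eliminating the term with zʲ⁺¹ by `X-suc` leaves a recurrence at a single power of z, whose
    -- coefficients are the weights of the level and down steps at an odd point.
    Y-step : ∀ j b → Y j (suc b) ≈ℂ (-ℂ conj (α b)) *ℂ X j (suc b) +ℂ (1ℂ -ℂ ofℝ ∣ α b ∣²) *ℂ Y j b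
    Y-step j b = begin
      Y j (suc b)
        ≈⟨ Y-suc j b ⟩
      y -ℂ ᾱ *ℂ X (ℤ.suc j) b
        ≈⟨ C.+-congˡ (C.trans (C.-‿cong (C.*-congˡ (X-suc j b))) (-‿distribˡ-* ᾱ _)) ⟩
      y +ℂ (-ℂ ᾱ) *ℂ (X j (suc b) +ℂ α b *ℂ y)
        ≈⟨ C.+-congˡ (C.distribˡ (-ℂ ᾱ) _ _) ⟩
      y +ℂ ((-ℂ ᾱ) *ℂ X j (suc b) +ℂ (-ℂ ᾱ) *ℂ (α b *ℂ y))
        ≈⟨ C.trans (C.sym (C.+-assoc y _ _)) (C.trans (C.+-congʳ (C.+-comm y _)) (C.+-assoc _ y _)) ⟩
      (-ℂ ᾱ) *ℂ X j (suc b) +ℂ (y +ℂ (-ℂ ᾱ) *ℂ (α b *ℂ y))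
        ≈⟨ C.+-congˡ (C.+-cong (C.sym (C.*-identityˡ y)) (C.trans (C.sym (C.*-assoc (-ℂ ᾱ) (α b) y)) (C.*-congʳ ᾱα))) ⟩
      (-ℂ ᾱ) *ℂ X j (suc b) +ℂ (1ℂ *ℂ y +ℂ (-ℂ ofℝ ∣ α b ∣²) *ℂ y)
        ≈⟨ C.+-congˡ (C.sym (C.distribʳ y 1ℂ _)) ⟩
      (-ℂ ᾱ) *ℂ X j (suc b) +ℂ (1ℂ -ℂ ofℝ ∣ α b ∣²) *ℂ y ∎
      where
      y = Y j b
      ᾱ = conj (α b)
      ᾱα : (-ℂ ᾱ) *ℂ α b ≈ℂ -ℂ ofℝ ∣ α b ∣²
      ᾱα = C.trans (C.sym (-‿distribˡ-* ᾱ (α b))) (C.-‿cong (C.trans (C.*-comm ᾱ (α b)) (z*conj-z (α b))))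

    W-even zero a b j _ h a≡c with (a , b) ≟ᴾ (c , d)
    -- At the target b = d, so the invariant forces j = 0, and the empty path contributes 1.
    ... | yes ≡.refl = C.trans (C.*-congʳ (C.+-identityʳ 1ℂ)) (C.trans (C.*-identityˡ _)
                         (C.reflexive (cong (λ i → X i b) (≡.sym (j≡0 j j+j≡0)))))
      where
      j+j≡0 : j ℤ.+ j ≡ + 0
      j+j≡0 = ℤ-+-cancelˡ (+ b) (j ℤ.+ j) (+ 0) h
      j≡0 : ∀ j → j ℤ.+ j ≡ + 0 → j ≡ + 0
      j≡0 (+ zero) _ = ≡.refl
    ... | no  ≢Q     = C.trans (C.zeroˡ _) (C.sym (X-base j b (≡.trans h (ℤ.+-identityʳ (+ d)))
                         λ b≡d → ≢Q (≡.cong₂ _,_ (≡.trans (≡.sym (ℤ.+-identityʳ a)) a≡c) b≡d)))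
    W-even (suc k) a b j e h a≡c = begin
      W (suc k) (a , b) (c , d) *ℂ X (+ 0) d
        ≈⟨ C.*-congʳ (C.trans (W-suc-even k a b (c , d) e) (C.+-congʳ (C.sym (C.*-identityˡ _)))) ⟩
      (1ℂ *ℂ W k (ℤ.suc a , suc b) (c , d) +ℂ α b *ℂ W k (ℤ.suc a , b) (c , d)) *ℂ X (+ 0) d
        ≈⟨ combine-* 1ℂ _ (α b) _ (X (+ 0) d)
             (W-even k (ℤ.suc a) (suc b) j′
               (≡.trans (parityAt-sucʳ (ℤ.suc a) b) (cong _⁻¹ odd)) hᵤ (next {k} {a} a≡c))
             (W-odd k (ℤ.suc a) b j′ odd hₗ (next {k} {a} a≡c)) ⟩
      1ℂ *ℂ X j′ (suc b) +ℂ α b *ℂ Y j′ b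
        ≈⟨ C.+-congʳ (C.*-identityˡ _) ⟩
      X j′ (suc b) +ℂ α b *ℂ Y j′ b
        ≈⟨ X-suc j′ b ⟨
      X (ℤ.suc j′) b
        ≈⟨ C.reflexive (cong (λ i → X i b) (ℤ.suc-pred j)) ⟩
      X j b ∎
      where
      -- One factor z is spent on leaving an even point.
      j′ = ℤ.pred j
      odd = ≡.trans (parityAt-sucˡ a b) (cong _⁻¹ e)
      open ℤSolver
      h′ : + b ℤ.+ (j ℤ.+ j) ℤ.+ -[1+ 0 ] ≡ + d ℤ.+ + k
      h′ = ≡.trans (cong (ℤ._+ -[1+ 0 ]) h)
        (solve 2 (λ d k → d :+ (con (+ 1) :+ k) :+ con -[1+ 0 ] := d :+ k) ≡.refl (+ d) (+ k))
      hᵤ = ≡.trans (solve 2 (λ b j → con (+ 1) :+ b :+ (con -[1+ 0 ] :+ j :+ (con -[1+ 0 ] :+ j))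
                                   := b :+ (j :+ j) :+ con -[1+ 0 ]) ≡.refl (+ b) j) h′
      hₗ = ≡.trans (solve 2 (λ b j → con (+ 1) :+ (b :+ (con -[1+ 0 ] :+ j :+ (con -[1+ 0 ] :+ j)))
                                   := b :+ (j :+ j) :+ con -[1+ 0 ]) ≡.refl (+ b) j) h′

    W-odd zero a b j _ h a≡c with (a , b) ≟ᴾ (c , d)
    -- The target is never reached at an odd point, since that would need 2j + 1 = 0.
    ... | yes ≡.refl = ⊥-elim (odd≢0 j (ℤ-+-cancelˡ (+ b) (ℤ.suc (j ℤ.+ j)) (+ 0) (≡.trans (ℤ-swap b j) h)))
      where
      ℤ-swap : ∀ b j → + b ℤ.+ ℤ.suc (j ℤ.+ j) ≡ ℤ.suc (+ b ℤ.+ (j ℤ.+ j))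
      ℤ-swap b j = solve 2 (λ b j → b :+ (con (+ 1) :+ (j :+ j)) := con (+ 1) :+ (b :+ (j :+ j))) ≡.refl (+ b) j
        where open ℤSolver
      odd≢0 : ∀ j → ℤ.suc (j ℤ.+ j) ≢ + 0
      odd≢0 (+ _)    ()
      odd≢0 -[1+ _ ] ()
    ... | no  _      = C.trans (C.zeroˡ _) (C.sym (Y-base j b (≡.trans h (ℤ.+-identityʳ (+ d)))))
    W-odd (suc k) a b j o h a≡c = go b o h
      where
      even : ∀ b → parityAt a b ≡ 1ℙ → parityAt (ℤ.suc a) b ≡ 0ℙ
      even b o = ≡.trans (parityAt-sucˡ a b) (cong _⁻¹ o)
      suc-inj : ∀ {i} → ℤ.suc i ≡ + d ℤ.+ + suc k → i ≡ + d ℤ.+ + k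
      suc-inj {i} h = ≡.trans (solve 1 (λ i → i := con (+ 1) :+ i :+ con -[1+ 0 ]) ≡.refl i)
        (≡.trans (cong (ℤ._+ -[1+ 0 ]) h)
          (solve 2 (λ d k → d :+ (con (+ 1) :+ k) :+ con -[1+ 0 ] := d :+ k) ≡.refl (+ d) (+ k)))
        where open ℤSolver
      go : ∀ b → parityAt a b ≡ 1ℙ → ℤ.suc (+ b ℤ.+ (j ℤ.+ j)) ≡ + d ℤ.+ + suc k →
           W (suc k) (a , b) (c , d) *ℂ X (+ 0) d ≈ℂ Y j b
      go zero o h = begin
        W (suc k) (a , 0) (c , d) *ℂ X (+ 0) d
          ≈⟨ C.*-congʳ (W-suc-odd-zero k a (c , d) o) ⟩
        W k (ℤ.suc a , 0) (c , d) *ℂ X (+ 0) d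
          ≈⟨ W-even k (ℤ.suc a) 0 j (even 0 o) (suc-inj h) (next {k} {a} a≡c) ⟩
        X j 0
          ≈⟨ Y-zero j ⟨
        Y j 0 ∎
      go (suc b) o h = begin
        W (suc k) (a , suc b) (c , d) *ℂ X (+ 0) d
          ≈⟨ C.*-congʳ (W-suc-odd-suc k a b (c , d) o) ⟩
        ((-ℂ conj (α b)) *ℂ W k (ℤ.suc a , suc b) (c , d) +ℂ (1ℂ -ℂ ofℝ ∣ α b ∣²) *ℂ W k (ℤ.suc a , b) (c , d)) *ℂ X (+ 0) d
          ≈⟨ combine-* (-ℂ conj (α b)) _ (1ℂ -ℂ ofℝ ∣ α b ∣²) _ (X (+ 0) d)
               (W-even k (ℤ.suc a) (suc b) j (even (suc b) o) (suc-inj h) (next {k} {a} a≡c))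
               (W-odd k (ℤ.suc a) b j
                 (≡.trans (parityAt-sucˡ a b) (≡.trans (≡.sym (parityAt-sucʳ a b)) o))
                 (≡.trans (≡.sym (ℤ.+-assoc (+ 1) (+ b) (j ℤ.+ j))) (suc-inj h)) (next {k} {a} a≡c)) ⟩
        (-ℂ conj (α b)) *ℂ X j (suc b) +ℂ (1ℂ -ℂ ofℝ ∣ α b ∣²) *ℂ Y j b
          ≈⟨ Y-step j b ⟨
        Y j (suc b) ∎

-- Norms and boundary cases

module _ (α : ℕ → ℂ) where

  -- Here ρ_i² = 1 - |α_i|². The product is kept real so that its positivity can be stated.
  ∏ρ² : ℕ → ℝ
  ∏ρ² zero    = 1ℝ
  ∏ρ² (suc d) = (1ℝ -ℝ ∣ α d ∣²) *ℝ ∏ρ² d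

  ∏ρ²-pos : (∀ n → ∣ α n ∣<1) → ∀ d → 0ℝ <ℝ ∏ρ² d
  -- The gap ½ witnesses 0 < 1.
  ∏ρ²-pos _     zero    = ½ , 0<½ , 0 , λ _ _ → ℚ.*<* (ℤ.+<+ (ℕ.s≤s (ℕ.s≤s ℕ.z≤n)))
  ∏ρ²-pos ∣α∣<1 (suc d) = 0<ℝ-* {1ℝ -ℝ ∣ α d ∣²} {∏ρ² d} (0<ℝ-1- {∣ α d ∣²} (∣α∣<1 d)) (∏ρ²-pos ∣α∣<1 d)

  module _ (m : ℤ → ℂ) (m₀≈1 : m (+ 0) ≈ℂ 1ℂ)
           (orthogonal : ∀ d b → d ≢ b → pair m (+ 0) (Φ α d) (Φ̂ m α b) ≈ℂ 0ℂ) where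

    κ≈∏ρ² : ∀ d → κ m α d ≈ℂ ofℝ (∏ρ² d)
    κ≈∏ρ² zero = begin
      pair m (+ 0) 1ᴸ (hat 1ᴸ)  ≈⟨ pair-zero m α (+ 0) 1ᴸ ⟩
      pair m (+ 0) 1ᴸ 1ᴸ        ≈⟨ ev-z^ (λ k → ev (λ l → m (+ 0 ℤ.+ (k ℤ.+ l))) 1ᴸ) (+ 0) ⟩
      ev (λ l → m (+ 0 ℤ.+ (+ 0 ℤ.+ l))) 1ᴸ  ≈⟨ ev-z^ (λ l → m (+ 0 ℤ.+ (+ 0 ℤ.+ l))) (+ 0) ⟩
      m (+ 0)                   ≈⟨ m₀≈1 ⟩
      1ℂ                        ∎
    κ≈∏ρ² (suc d) = begin
      κ m α (suc d)                        ≈⟨ κ-suc m α orthogonal d ⟩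
      (1ℂ -ℂ ofℝ ∣ α d ∣²) *ℂ κ m α d      ≈⟨ C.*-cong (pointwiseℂ (λ _ → ≡.refl) (λ _ → ≡.refl)) (κ≈∏ρ² d) ⟩
      ofℝ (1ℝ -ℝ ∣ α d ∣²) *ℂ ofℝ (∏ρ² d)  ≈⟨ ofℝ-* (1ℝ -ℝ ∣ α d ∣²) (∏ρ² d) ⟩
      ofℝ (∏ρ² (suc d))                    ∎

    -- For j > 0 the equation gives j + b < d, so zʲΦ_b has too low a degree to pair with Φ_d. For j
    -- < 0 the power of z moves to the other side and the roles swap, since then -j + d < b.
    X-base : ∀ d j b → + b ℤ.+ (j ℤ.+ j) ≡ + d → b ≢ d → Xᵣ m α d j b ≈ℂ 0ℂ
    X-base d (+ zero) b h b≢d = ⊥-elim (b≢d (ℤ.+-injective (≡.trans (≡.sym (ℤ.+-identityʳ (+ b))) h)))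
    X-base d (+ suc j) b h _ = Xᵣ-vanish m α orthogonal d (suc j) b
      (≡.subst (suc j ℕ.+ b ℕ.<_) (≡.trans
        (solve 2 (λ j b → con 1 :+ (con 1 :+ j :+ b) :+ j := b :+ (con 1 :+ j :+ (con 1 :+ j))) ≡.refl j b)
        (ℤ.+-injective h)) (ℕ.m≤m+n (suc (suc j ℕ.+ b)) j))
      where open ℕSolver
    X-base d -[1+ i ] b h _ = C.trans
      (pair-sym m (+ suc i) (Φ α d) (Φ̂ m α b))
      (Xₗ-vanish m α orthogonal b (suc i) d (≡.subst (suc i ℕ.+ d ℕ.<_) (≡.sym b≡) (ℕ.m≤m+n (suc (suc i ℕ.+ d)) i)))
      where
      b≡ : b ≡ suc (suc i ℕ.+ d) ℕ.+ i
      b≡ = ℤ.+-injective (≡.trans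
        (solve 2 (λ b i → b := b :+ (:- (con (+ 1) :+ i) :+ :- (con (+ 1) :+ i)) :+ (con (+ 1) :+ i :+ (con (+ 1) :+ i))) ≡.refl (+ b) (+ i))
        (≡.trans (cong (ℤ._+ (+ suc i ℤ.+ + suc i)) h)
          (solve 2 (λ d i → d :+ (con (+ 1) :+ i :+ (con (+ 1) :+ i)) := con (+ 1) :+ (con (+ 1) :+ i :+ d) :+ i) ≡.refl (+ d) (+ i))))
        where open ℤSolver

    -- For j ≥ 0 the equation gives j + b < d and degree decides; negative j is reduced to that case
    -- by exchanging b and d.
    Y-base : ∀ d j b → ℤ.suc (+ b ℤ.+ (j ℤ.+ j)) ≡ + d → Yᵣ m α d j b ≈ℂ 0ℂ
    Y-base d (+ j) b h = Yᵣ-vanish m α orthogonal d j b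
      (≡.subst (j ℕ.+ b ℕ.<_) (≡.trans
        (solve 2 (λ j b → con 1 :+ (j :+ b) :+ j := con 1 :+ (b :+ (j :+ j))) ≡.refl j b)
        (ℤ.+-injective h)) (ℕ.m≤m+n (suc (j ℕ.+ b)) j))
      where open ℕSolver
    -- ⟨Φ_d , z⁻ⁱ⁻¹Φ*_b⟩ = ⟨Φ_b , zⁱΦ*_d⟩, since b = d + 2i + 1
    Y-base d -[1+ i ] b h = begin
      pair m (+ suc i ℤ.+ ℤ.- + b) (Φ α d) (Φ α b)
        ≈⟨ pair-sym m (+ suc i ℤ.+ ℤ.- + b) (Φ α d) (Φ α b) ⟩
      pair m (+ suc i ℤ.+ ℤ.- + b) (Φ α b) (Φ α d)
        ≈⟨ pair-index m (Φ α b) (Φ α d) (≡.trans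
             (cong (λ t → + suc i ℤ.+ ℤ.- + t) b≡)
             (solve 2 (λ d i → con (+ 1) :+ i :+ :- (con (+ 1) :+ (i :+ d) :+ i) := :- i :+ :- d) ≡.refl (+ d) (+ i))) ⟩
      Yᵣ m α b (+ i) d
        ≈⟨ Yᵣ-vanish m α orthogonal b i d (≡.subst (i ℕ.+ d ℕ.<_) (≡.sym b≡) (ℕ.m≤m+n (suc (i ℕ.+ d)) i)) ⟩
      0ℂ ∎
      where
      open ℤSolver
      b≡ : b ≡ suc (i ℕ.+ d) ℕ.+ i
      b≡ = ℤ.+-injective (≡.trans
        (solve 2 (λ b i → b := con (+ 1) :+ (b :+ (:- (con (+ 1) :+ i) :+ :- (con (+ 1) :+ i))) :+ (con (+ 1) :+ i :+ i)) ≡.refl (+ b) (+ i))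
        (≡.trans (cong (ℤ._+ (+ suc i ℤ.+ + i)) h)
          (solve 2 (λ d i → d :+ (con (+ 1) :+ i :+ i) := con (+ 1) :+ (i :+ d) :+ i) ≡.refl (+ d) (+ i))))

    -- The paths have length k = 2n - s + r. The start (-r , r) is even, and r + 2n = s + k is the
    -- invariant with j = n.
    ∑wt-gMot : ∀ n r s → ∑wt α (gMot (ℤ.- + r , r) (+ (2 ℕ.* n) ℤ.- + s , s)) *ℂ κ m α s ≈ℂ Xᵣ m α s (+ n) r
    ∑wt-gMot n r s with + (2 ℕ.* n) ℤ.- + s ℤ.- ℤ.- + r in eq
    ... | + k = W-even α (ladderᵣ m α s) c s (X-base s) (Y-base s) k (ℤ.- + r) r (+ n)
      (cong (λ i → parity ℤ.∣ i ∣) (ℤ.+-inverseˡ (+ r)))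
      (≡.trans (solve 3 (λ n r s → r :+ (n :+ n) := s :+ (n :+ (n :+ con (+ 0)) :- s :- :- r)) ≡.refl (+ n) (+ r) (+ s))
               (cong (λ i → + s ℤ.+ i) eq))
      (≡.trans (cong (λ i → ℤ.- + r ℤ.+ i) (≡.sym eq))
               (solve 2 (λ c r → :- r :+ (c :- :- r) := c) ≡.refl c (+ r)))
      where
      c = + (2 ℕ.* n) ℤ.- + s
      open ℤSolver
    -- The endpoint lies left of the start, so there are no paths. Then 2n + r < s, hence n + r < s,
    -- and zⁿΦ_r has too low a degree to pair with Φ_s.
    ... | -[1+ k ] = C.trans (C.zeroˡ _) (C.sym (Xᵣ-vanish m α orthogonal s n r
      (≡.subst (n ℕ.+ r ℕ.<_) (≡.sym s≡) (ℕ.m≤m+n (suc (n ℕ.+ r)) (n ℕ.+ k)))))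
      where
      open ℤSolver
      s≡ : s ≡ suc (n ℕ.+ r) ℕ.+ (n ℕ.+ k)
      s≡ = ℤ.+-injective (≡.trans
        (solve 4 (λ n r s k →
            s := r :+ (n :+ n) :+ con (+ 1) :+ k :+ (:- (con (+ 1) :+ k) :- (n :+ (n :+ con (+ 0)) :- s :- :- r))) ≡.refl (+ n) (+ r) (+ s) (+ k))
        (≡.trans (cong (λ i → + r ℤ.+ (+ n ℤ.+ + n) ℤ.+ + 1 ℤ.+ + k ℤ.+ (-[1+ k ] ℤ.- i)) eq)
          (solve 3 (λ n r k →
              r :+ (n :+ n) :+ con (+ 1) :+ k :+ (:- (con (+ 1) :+ k) :- (:- (con (+ 1) :+ k))) := con (+ 1) :+ (n :+ r) :+ (n :+ k)) ≡.refl (+ n) (+ r) (+ k))))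

theorem3p7 : (α : ℕ → ℂ) → (∀ n → ∣ α n ∣<1) →
    (L : Laurent → ℂ) → IsLinearFunctional L → L 1ᴸ ≈ℂ 1ℂ → IsOrthogonal α L →
    ∀ n r s →
    Σ (⟪ Φ α s , Φ α s ⟫[ L ] #0) λ Φₛ#0 →
    μ α L n r s Φₛ#0 ≈ℂ
    ∑ (map (wt α) (gMot (ℤ.- (+ r) , r) (+ (2 ℕ.* n) ℤ.- + s , s)))
-- It suffices that the path sum times ⟨Φ_s , Φ_s⟩ is the numerator ⟨Φ_s , zⁿΦ_r⟩.
theorem3p7 α ∣α∣<1 L isLinear L1≈1 orth n r s = Φₛ#0 , divide-≈ ⟪ Φ α s , Φ α s ⟫[ L ] Φₛ#0 (begin
    ∑wt α paths *ℂ ⟪ Φ α s , Φ α s ⟫[ L ]  ≈⟨ C.*-congˡ (⟪⟫≈pair (Φ α s) (Φ α s)) ⟩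
    ∑wt α paths *ℂ κ m α s                 ≈⟨ ∑wt-gMot α m L1≈1 orthogonal n r s ⟩
    pair m (ℤ.- + n) (Φ α s) (hat (Φ α r))
      -- Under `hat` the factor zⁿ becomes z⁻ⁿ, which is absorbed into the shift of `pair`.
      ≈⟨ ev-cong (λ k → C.trans (ev-hat-shift (λ l → m (+ 0 ℤ.+ (k ℤ.+ l))) (+ n) (Φ α r))
           (ev-cong (λ l → C.reflexive (cong m
             (solve 3 (λ n k l → con (+ 0) :+ (k :+ (:- n :+ l)) := :- n :+ (k :+ l)) ≡.refl (+ n) k l)))
             (hat (Φ α r)))) (Φ α s) ⟨
    pair m (+ 0) (Φ α s) (hat ((z^ (+ n)) *ᴸ Φ α r))  ≈⟨ ⟪⟫≈pair (Φ α s) ((z^ (+ n)) *ᴸ Φ α r) ⟨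
    ⟪ Φ α s , (z^ (+ n)) *ᴸ Φ α r ⟫[ L ]   ∎)
  where
  open ℤSolver
  m : ℤ → ℂ
  m k = L (z^ k)
  paths = gMot (ℤ.- (+ r) , r) (+ (2 ℕ.* n) ℤ.- + s , s)
  ⟪⟫≈pair : ∀ f g → ⟪ f , g ⟫[ L ] ≈ℂ pair m (+ 0) f (hat g)
  ⟪⟫≈pair f g = C.trans (functional≈ev isLinear (f *ᴸ hat g)) (C.trans (ev-*ᴸ m f (hat g))
    (ev-cong (λ k → ev-cong (λ l → C.reflexive (cong m (≡.sym (ℤ.+-identityˡ (k ℤ.+ l))))) (hat g)) f))
  orthogonal : ∀ d b → d ≢ b → pair m (+ 0) (Φ α d) (hat (Φ α b)) ≈ℂ 0ℂ
  orthogonal d b d≢b = C.trans (C.sym (⟪⟫≈pair (Φ α d) (Φ α b))) (orth d b d≢b)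
  Φₛ#0 : ⟪ Φ α s , Φ α s ⟫[ L ] #0
  -- The squared norm is the product of the 1 - |α_i|² for i < s, a positive real.
  Φₛ#0 = #0-resp (C.sym (C.trans (⟪⟫≈pair (Φ α s) (Φ α s)) (κ≈∏ρ² α m L1≈1 orthogonal s)))
                 (0<⇒ofℝ#0 {∏ρ² α s} (∏ρ²-pos α ∣α∣<1 s))
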